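{- Let $n\ge 1$ and let $b=(b_1,\dots,b_n)$ be a sequence of positive integers. Then the Ehrhart ring $E(b)$ of the lecture hall polytope $P(b)$ is Koszul.
   Context: The lecture hall polytope is $P(b):=\{(x_1,\dots,x_n)\in\mathbb{R}^n : 0\le\frac{x_1}{b_1}\le\cdots\le\frac{x_n}{b_n}\le 1\}$. For $p=(p_1,\dots,p_n)\in kP(b)\cap\mathbb{Z}^n$, $k\in\mathbb{Z}_{\ge 0}$, put $t^{(p,k)}:=t_1^{p_1}\cdots t_n^{p_n}t_{n+1}^k$. The Ehrhart ring of $P(b)$ is the graded algebra $E(b):=\bigoplus_{k\ge 0}E(b)_k$, $E(b)_k:=\langle t^{(p,k)}\mid p\in kP(b)\cap\mathbb{Z}^n\rangle_{\mathbb{C}}$, with multiplication $t^{(p,k)}\cdot t^{(q,h)}=t^{(p+q,k+h)}$. A standard graded $\mathbb{C}$-algebra $A$ is Koszul if its residue field $\mathbb{C}=A/A_{>0}$ has a linear graded free resolution over $A$. -}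

module Defs where

import Algebra.Definitions.RawMonoid as RawMonoidDefs
import Algebra.Properties.CommutativeMonoid.Sum as SumProperties
import Algebra.Properties.CommutativeSemigroup as CommutativeSemigroupProperties
import Algebra.Properties.Ring as RingProperties
import Data.Fin.Properties as Finₚ
import Data.Integer.Properties as ℤₚ
import Data.Nat.Properties as ℕₚ
import Data.Product.Properties as Productₚ
import Data.Rational.Properties as ℚₚ
import Data.Rational.Unnormalised.Base as ℚᵘ
import Data.Rational.Unnormalised.Properties as ℚᵘₚ
import Data.Rational.Solver as ℚ-Solver
import Relation.Binary.Reasoning.Setoid as SetoidReasoning
open import Algebra.Bundles using (CommutativeRing; CommutativeMonoid)
open import Algebra.Module.Bundles using (LeftModule)
open import Algebra.Module.Morphism.Structures using (module LeftModuleMorphisms)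
open import Algebra.Morphism.Structures using (module MonoidMorphisms; module RingMorphisms)
open import Data.Bool.Base using (if_then_else_; true; false)
open import Data.Fin.Base as Fin using (Fin; toℕ)
open import Data.Integer as ℤ using (ℤ; +_)
open import Data.List.Base using (List; []; _∷_; _++_; map; filter; length)
open import Data.List.Properties using (++-assoc; ++-identityʳ)
open import Data.List.Relation.Unary.All as All using (All; []; _∷_)
import Data.List.Relation.Unary.All.Properties as Allₚ
open import Data.Nat as ℕ using (ℕ; zero; suc)
open import Data.Product.Base using (_×_; _,_; proj₁; proj₂; Σ-syntax; ∃-syntax)
open import Data.Rational.Base as ℚ using (ℚ; 0ℚ; 1ℚ; ½)
open import Data.Rational.Literals using (fromℤ)
open import Data.Sum.Base using (inj₁; inj₂)
open import Data.Vec.Base as Vec using (Vec)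
import Data.Vec.Properties as Vecₚ
open import Data.Vec.Functional using (Vector)
open import Function.Base using (_∘_)
open import Function.Bundles using (_⇔_)
open import Level using (Level; _⊔_; Lift; 0ℓ) renaming (suc to lsuc)
open import Relation.Binary.Definitions using (Decidable)
open import Relation.Binary.PropositionalEquality as ≡
  using (_≡_; _≗_; cong; cong₂; subst; subst₂)
open import Relation.Nullary using (¬_; yes; no; does; contradiction)
open import Relation.Nullary.Decidable using (dec-true; dec-false)

open LeftModuleMorphisms using (IsLeftModuleHomomorphism)
open MonoidMorphisms using (IsMonoidHomomorphism)
open RingMorphisms using (IsRingHomomorphism)

-- A real is a Cauchy sequence of rationals; two reals are equal if the
-- difference of the sequences tends to 0, so that the ring operations
-- are pointwise.

module Real where

  open ≡ using (refl; sym; trans)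
  open ℚ-Solver.+-*-Solver using (solve; _:=_; _:+_; _:*_; _:-_; :-_; con)

  record ℝ : Set where
    constructor mkℝ
    field
      seq    : ℕ → ℚ
      cauchy : ∀ ε → 0ℚ ℚ.< ε → ∃[ N ] ∀ m n → N ℕ.≤ m → N ℕ.≤ n →
               ℚ.∣ seq m ℚ.- seq n ∣ ℚ.< ε
  open ℝ public

  infix 4 _≈_ _≤_

  _≈_ : ℝ → ℝ → Set
  x ≈ y = ∀ ε → 0ℚ ℚ.< ε → ∃[ N ] ∀ n → N ℕ.≤ n →
          ℚ.∣ seq x n ℚ.- seq y n ∣ ℚ.< ε

  -- x ≤ y means that x - y is eventually below every ε > 0.
  _≤_ : ℝ → ℝ → Set
  x ≤ y = ∀ ε → 0ℚ ℚ.< ε → ∃[ N ] ∀ n → N ℕ.≤ n →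
          seq x n ℚ.- seq y n ℚ.< ε

  0<½* : ∀ {ε} → 0ℚ ℚ.< ε → 0ℚ ℚ.< ½ ℚ.* ε
  0<½* {ε} 0<ε = subst (ℚ._< ½ ℚ.* ε) (ℚₚ.*-zeroʳ ½) (ℚₚ.*-monoʳ-<-pos ½ 0<ε)

  ½+½ : ∀ ε → ½ ℚ.* ε ℚ.+ ½ ℚ.* ε ≡ ε
  ½+½ = solve 1 (λ e → con ½ :* e :+ con ½ :* e := e) refl

  0<1 : 0ℚ ℚ.< 1ℚ
  0<1 = ℚₚ.positive⁻¹ 1ℚ

  0<+1 : ∀ {p} → 0ℚ ℚ.≤ p → 0ℚ ℚ.< p ℚ.+ 1ℚ
  0<+1 {p} 0≤p = ℚₚ.≤-<-trans 0≤p (subst (ℚ._< p ℚ.+ 1ℚ) (ℚₚ.+-identityʳ p) (ℚₚ.+-monoʳ-< p 0<1))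

  p-p≡0 : ∀ p → p ℚ.- p ≡ 0ℚ
  p-p≡0 = ℚₚ.+-inverseʳ

  p<q⇒p-q<0 : ∀ {p q} → p ℚ.< q → p ℚ.- q ℚ.< 0ℚ
  p<q⇒p-q<0 {p} {q} p<q = subst (p ℚ.- q ℚ.<_) (p-p≡0 q) (ℚₚ.+-monoˡ-< (ℚ.- q) p<q)

  p≤q⇒p-q≤0 : ∀ {p q} → p ℚ.≤ q → p ℚ.- q ℚ.≤ 0ℚ
  p≤q⇒p-q≤0 {p} {q} p≤q = subst (p ℚ.- q ℚ.≤_) (p-p≡0 q) (ℚₚ.+-monoˡ-≤ (ℚ.- q) p≤q)

  p≤∣p∣ : ∀ p → p ℚ.≤ ℚ.∣ p ∣
  p≤∣p∣ p with ℚₚ.≤-total 0ℚ p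
  ... | inj₁ 0≤p = ℚₚ.≤-reflexive (sym (ℚₚ.0≤p⇒∣p∣≡p 0≤p))
  ... | inj₂ p≤0 = ℚₚ.≤-trans p≤0 (ℚₚ.0≤∣p∣ p)

  divide : ∀ {B ε} → 0ℚ ℚ.< B → 0ℚ ℚ.< ε → ∃[ δ ] 0ℚ ℚ.< δ × B ℚ.* δ ≡ ε
  divide {B} {ε} 0<B 0<ε = 1/B ℚ.* ε , 0<δ ,
    trans (sym (ℚₚ.*-assoc B 1/B ε))
      (trans (cong (ℚ._* ε) (ℚₚ.*-inverseʳ B {{B≢0}})) (ℚₚ.*-identityˡ ε))
    where
    B>0 = ℚ.positive 0<B
    B≢0 = ℚₚ.pos⇒nonZero B {{B>0}}
    1/B = (ℚ.1/ B) {{B≢0}}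
    0<δ : 0ℚ ℚ.< 1/B ℚ.* ε
    0<δ = subst (ℚ._< 1/B ℚ.* ε) (ℚₚ.*-zeroʳ 1/B)
            (ℚₚ.*-monoʳ-<-pos 1/B {{ℚₚ.1/pos⇒pos B {{B>0}}}} 0<ε)

  -- Single limits (I = ℕ) and double limits (I = ℕ × ℕ), with Large N i
  -- saying that the index i is beyond N.
  module Smallness {I : Set} (Large : ℕ → I → Set)
                   (antitone : ∀ {M N} → M ℕ.≤ N → ∀ {i} → Large N i → Large M i) where

    record Small (f : I → ℚ) : Set where
      constructor small
      field
        bound : ∀ ε → 0ℚ ℚ.< ε → ∃[ N ] ∀ i → Large N i → ℚ.∣ f i ∣ ℚ.< ε
    open Small public

    small-≗ : ∀ {f g} → f ≗ g → Small f → Small g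
    small-≗ f≗g s .bound ε 0<ε with s .bound ε 0<ε
    ... | N , b = N , λ i l → subst (λ z → ℚ.∣ z ∣ ℚ.< ε) (f≗g i) (b i l)

    small-0 : Small (λ _ → 0ℚ)
    small-0 .bound ε 0<ε = 0 , λ _ _ → 0<ε

    small-+ : ∀ {f g} → Small f → Small g → Small (λ i → f i ℚ.+ g i)
    small-+ {f} {g} sf sg .bound ε 0<ε
      with sf .bound (½ ℚ.* ε) (0<½* 0<ε) | sg .bound (½ ℚ.* ε) (0<½* 0<ε)
    ... | M , bf | N , bg = M ℕ.⊔ N , λ i l →
      subst (ℚ.∣ f i ℚ.+ g i ∣ ℚ.<_) (½+½ ε)
        (ℚₚ.≤-<-trans (ℚₚ.∣p+q∣≤∣p∣+∣q∣ (f i) (g i))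
          (ℚₚ.+-mono-< (bf i (antitone (ℕₚ.m≤m⊔n M N) l))
                       (bg i (antitone (ℕₚ.m≤n⊔m M N) l))))

    small-neg : ∀ {f} → Small f → Small (λ i → ℚ.- f i)
    small-neg {f} sf .bound ε 0<ε with sf .bound ε 0<ε
    ... | N , b = N , λ i l → subst (ℚ._< ε) (sym (ℚₚ.∣-p∣≡∣p∣ (f i))) (b i l)

    record Bounded (g : I → ℚ) : Set where
      constructor bounded
      field
        from  : ℕ
        by    : ℚ
        0<by  : 0ℚ ℚ.< by
        ∣g∣≤by : ∀ i → Large from i → ℚ.∣ g i ∣ ℚ.≤ by

    small-* : ∀ {f g} → Bounded g → Small f → Small (λ i → g i ℚ.* f i)
    small-* {f} {g} (bounded M B 0<B bg) sf .bound ε 0<ε with divide 0<B 0<ε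
    ... | δ , 0<δ , Bδ≡ε with sf .bound δ 0<δ
    ... | N , bf = M ℕ.⊔ N , λ i l →
      subst₂ ℚ._<_ (sym (ℚₚ.∣p*q∣≡∣p∣*∣q∣ (g i) (f i))) Bδ≡ε
        (ℚₚ.≤-<-trans
          (ℚₚ.*-monoʳ-≤-nonNeg ℚ.∣ f i ∣ {{ℚₚ.∣-∣-nonNeg (f i)}}
            (bg i (antitone (ℕₚ.m≤m⊔n M N) l)))
          (ℚₚ.*-monoʳ-<-pos B {{ℚ.positive 0<B}}
            (bf i (antitone (ℕₚ.m≤n⊔m M N) l))))

  module Single = Smallness {ℕ} ℕ._≤_ (λ M≤N N≤i → ℕₚ.≤-trans M≤N N≤i)

  module Double = Smallness {ℕ × ℕ}
    (λ N (m , n) → N ℕ.≤ m × N ℕ.≤ n)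
    (λ M≤N (p , q) → ℕₚ.≤-trans M≤N p , ℕₚ.≤-trans M≤N q)

  Cauchy : (ℕ → ℚ) → Set
  Cauchy f = ∀ ε → 0ℚ ℚ.< ε → ∃[ N ] ∀ m n → N ℕ.≤ m → N ℕ.≤ n →
             ℚ.∣ f m ℚ.- f n ∣ ℚ.< ε

  cauchy⇒small : ∀ x → Double.Small (λ (m , n) → seq x m ℚ.- seq x n)
  cauchy⇒small x .Double.bound ε 0<ε with cauchy x ε 0<ε
  ... | N , b = N , λ (m , n) (p , q) → b m n p q

  small⇒cauchy : ∀ f → Double.Small (λ (m , n) → f m ℚ.- f n) → Cauchy f
  small⇒cauchy f s ε 0<ε with s .Double.bound ε 0<ε
  ... | N , b = N , λ m n p q → b (m , n) (p , q)

  ≈⇒small : ∀ x y → x ≈ y → Single.Small (λ n → seq x n ℚ.- seq y n)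
  ≈⇒small x y x≈y = Single.small x≈y

  small⇒≈ : ∀ x y → Single.Small (λ n → seq x n ℚ.- seq y n) → x ≈ y
  small⇒≈ x y = Single.bound

  bounded : ∀ x → Single.Bounded (seq x)
  bounded x with cauchy x 1ℚ 0<1
  ... | N , b = Single.bounded N (ℚ.∣ seq x N ∣ ℚ.+ 1ℚ)
    (0<+1 (ℚₚ.0≤∣p∣ (seq x N)))
    (λ n N≤n → subst (ℚ._≤ ℚ.∣ seq x N ∣ ℚ.+ 1ℚ) (cong ℚ.∣_∣ (lem (seq x N) (seq x n)))
      (ℚₚ.≤-trans (ℚₚ.∣p+q∣≤∣p∣+∣q∣ (seq x N) (seq x n ℚ.- seq x N))
        (ℚₚ.+-monoʳ-≤ ℚ.∣ seq x N ∣ (ℚₚ.<⇒≤ (b n N N≤n ℕₚ.≤-refl)))))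
    where
    lem : ∀ p q → p ℚ.+ (q ℚ.- p) ≡ q
    lem = solve 2 (λ p q → p :+ (q :- p) := q) refl

  boundedˡ : ∀ x → Double.Bounded (λ (m , n) → seq x m)
  boundedˡ x = Double.bounded from by 0<by (λ (m , n) (p , q) → ∣g∣≤by m p)
    where open Single.Bounded (bounded x)

  boundedʳ : ∀ x → Double.Bounded (λ (m , n) → seq x n)
  boundedʳ x = Double.bounded from by 0<by (λ (m , n) (p , q) → ∣g∣≤by n q)
    where open Single.Bounded (bounded x)

  ι : ℚ → ℝ
  ι q = mkℝ (λ _ → q) (small⇒cauchy (λ _ → q) (Double.small-≗ {λ _ → 0ℚ} {λ _ → q ℚ.- q} (λ _ → sym (p-p≡0 q)) Double.small-0))

  infixl 6 _+_
  infixl 7 _*_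
  infix  8 -_

  _+_ : ℝ → ℝ → ℝ
  x + y = mkℝ (λ n → seq x n ℚ.+ seq y n)
    (small⇒cauchy (λ n → seq x n ℚ.+ seq y n) (Double.small-≗ (λ (m , n) → lem (seq x m) (seq x n) (seq y m) (seq y n))
      (Double.small-+ (cauchy⇒small x) (cauchy⇒small y))))
    where
    lem : ∀ a b c d → (a ℚ.- b) ℚ.+ (c ℚ.- d) ≡ (a ℚ.+ c) ℚ.- (b ℚ.+ d)
    lem = solve 4 (λ a b c d → (a :- b) :+ (c :- d) := (a :+ c) :- (b :+ d)) refl

  -_ : ℝ → ℝ
  - x = mkℝ (λ n → ℚ.- seq x n)
    (small⇒cauchy (λ n → ℚ.- seq x n) (Double.small-≗ (λ (m , n) → lem (seq x m) (seq x n))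
      (Double.small-neg (cauchy⇒small x))))
    where
    lem : ∀ a b → ℚ.- (a ℚ.- b) ≡ ℚ.- a ℚ.- ℚ.- b
    lem = solve 2 (λ a b → :- (a :- b) := :- a :- :- b) refl

  _*_ : ℝ → ℝ → ℝ
  x * y = mkℝ (λ n → seq x n ℚ.* seq y n)
    (small⇒cauchy (λ n → seq x n ℚ.* seq y n) (Double.small-≗ (λ (m , n) → lem (seq x m) (seq x n) (seq y m) (seq y n))
      (Double.small-+ (Double.small-* (boundedˡ x) (cauchy⇒small y))
                      (Double.small-* (boundedʳ y) (cauchy⇒small x)))))
    where
    lem : ∀ a b c d → a ℚ.* (c ℚ.- d) ℚ.+ d ℚ.* (a ℚ.- b) ≡ a ℚ.* c ℚ.- b ℚ.* d
    lem = solve 4 (λ a b c d → a :* (c :- d) :+ d :* (a :- b) := a :* c :- b :* d) refl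

  ≈-pointwise : ∀ {x y} → seq x ≗ seq y → x ≈ y
  ≈-pointwise {x} {y} x≗y = small⇒≈ x y (Single.small-≗
    (λ n → trans (sym (p-p≡0 (seq x n))) (cong (λ z → seq x n ℚ.- z) (x≗y n))) Single.small-0)

  ≈-refl : ∀ {x} → x ≈ x
  ≈-refl {x} = ≈-pointwise {x} {x} (λ _ → refl)

  ≈-sym : ∀ {x y} → x ≈ y → y ≈ x
  ≈-sym {x} {y} x≈y = small⇒≈ y x
    (Single.small-≗ (λ n → lem (seq x n) (seq y n)) (Single.small-neg (≈⇒small x y x≈y)))
    where
    lem : ∀ a b → ℚ.- (a ℚ.- b) ≡ b ℚ.- a
    lem = solve 2 (λ a b → :- (a :- b) := b :- a) refl

  ≈-trans : ∀ {x y z} → x ≈ y → y ≈ z → x ≈ z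
  ≈-trans {x} {y} {z} x≈y y≈z = small⇒≈ x z
    (Single.small-≗ (λ n → lem (seq x n) (seq y n) (seq z n))
      (Single.small-+ (≈⇒small x y x≈y) (≈⇒small y z y≈z)))
    where
    lem : ∀ a b c → (a ℚ.- b) ℚ.+ (b ℚ.- c) ≡ a ℚ.- c
    lem = solve 3 (λ a b c → (a :- b) :+ (b :- c) := a :- c) refl

  +-cong : ∀ {x y u v} → x ≈ y → u ≈ v → x + u ≈ y + v
  +-cong {x} {y} {u} {v} x≈y u≈v = small⇒≈ (x + u) (y + v)
    (Single.small-≗ (λ n → lem (seq x n) (seq y n) (seq u n) (seq v n))
      (Single.small-+ (≈⇒small x y x≈y) (≈⇒small u v u≈v)))
    where
    lem : ∀ a b c d → (a ℚ.- b) ℚ.+ (c ℚ.- d) ≡ (a ℚ.+ c) ℚ.- (b ℚ.+ d)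
    lem = solve 4 (λ a b c d → (a :- b) :+ (c :- d) := (a :+ c) :- (b :+ d)) refl

  -‿cong : ∀ {x y} → x ≈ y → - x ≈ - y
  -‿cong {x} {y} x≈y = small⇒≈ (- x) (- y)
    (Single.small-≗ (λ n → lem (seq x n) (seq y n)) (Single.small-neg (≈⇒small x y x≈y)))
    where
    lem : ∀ a b → ℚ.- (a ℚ.- b) ≡ ℚ.- a ℚ.- ℚ.- b
    lem = solve 2 (λ a b → :- (a :- b) := :- a :- :- b) refl

  *-cong : ∀ {x y u v} → x ≈ y → u ≈ v → x * u ≈ y * v
  *-cong {x} {y} {u} {v} x≈y u≈v = small⇒≈ (x * u) (y * v)
    (Single.small-≗ (λ n → lem (seq x n) (seq y n) (seq u n) (seq v n))
      (Single.small-+ (Single.small-* (bounded x) (≈⇒small u v u≈v))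
                      (Single.small-* (bounded v) (≈⇒small x y x≈y))))
    where
    lem : ∀ a b c d → a ℚ.* (c ℚ.- d) ℚ.+ d ℚ.* (a ℚ.- b) ≡ a ℚ.* c ℚ.- b ℚ.* d
    lem = solve 4 (λ a b c d → a :* (c :- d) :+ d :* (a :- b) := a :* c :- b :* d) refl

  ≤-reflexive : ∀ {x y} → x ≈ y → x ≤ y
  ≤-reflexive {x} {y} x≈y ε 0<ε with x≈y ε 0<ε
  ... | N , b = N , λ n N≤n → ℚₚ.≤-<-trans (p≤∣p∣ (seq x n ℚ.- seq y n)) (b n N≤n)

  ≤-trans : ∀ {x y z} → x ≤ y → y ≤ z → x ≤ z
  ≤-trans {x} {y} {z} x≤y y≤z ε 0<ε with x≤y (½ ℚ.* ε) (0<½* 0<ε) | y≤z (½ ℚ.* ε) (0<½* 0<ε)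
  ... | M , b | N , c = M ℕ.⊔ N , λ n l →
    subst₂ ℚ._<_ (lem (seq x n) (seq y n) (seq z n)) (½+½ ε)
      (ℚₚ.+-mono-< (b n (ℕₚ.≤-trans (ℕₚ.m≤m⊔n M N) l)) (c n (ℕₚ.≤-trans (ℕₚ.m≤n⊔m M N) l)))
    where
    lem : ∀ a b c → (a ℚ.- b) ℚ.+ (b ℚ.- c) ≡ a ℚ.- c
    lem = solve 3 (λ a b c → (a :- b) :+ (b :- c) := a :- c) refl

  ι-mono-≤ : ∀ {p q} → p ℚ.≤ q → ι p ≤ ι q
  ι-mono-≤ p≤q ε 0<ε = 0 , λ _ _ → ℚₚ.≤-<-trans (p≤q⇒p-q≤0 p≤q) 0<ε

  ι-cancel-≤ : ∀ {p q} → ι p ≤ ι q → p ℚ.≤ q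
  ι-cancel-≤ {p} {q} ιp≤ιq = ℚₚ.≮⇒≥ λ q<p →
    let 0<p-q = subst (ℚ._< p ℚ.- q) (p-p≡0 q) (ℚₚ.+-monoˡ-< (ℚ.- q) q<p)
        (N , b) = ιp≤ιq (p ℚ.- q) 0<p-q
    in ℚₚ.<-irrefl refl (b N ℕₚ.≤-refl)

  *-monoˡ-≤ : ∀ {r x y} → 0ℚ ℚ.≤ r → x ≤ y → ι r * x ≤ ι r * y
  *-monoˡ-≤ {r} {x} {y} 0≤r x≤y ε 0<ε with divide 0<r+1 0<ε
    where
    0<r+1 : 0ℚ ℚ.< r ℚ.+ 1ℚ
    0<r+1 = 0<+1 0≤r
  ... | δ , 0<δ , r+1δ≡ε with x≤y δ 0<δ
  ... | N , b = N , λ n N≤n →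
    subst₂ ℚ._<_ (lem r (seq x n) (seq y n)) r+1δ≡ε
      (ℚₚ.≤-<-trans
        (ℚₚ.*-monoˡ-≤-nonNeg r {{ℚ.nonNegative 0≤r}} (ℚₚ.<⇒≤ (b n N≤n)))
        (ℚₚ.*-monoˡ-<-pos δ {{ℚ.positive 0<δ}}
          (subst (ℚ._< r ℚ.+ 1ℚ) (ℚₚ.+-identityʳ r) (ℚₚ.+-monoʳ-< r 0<1))))
    where
    lem : ∀ r a b → r ℚ.* (a ℚ.- b) ≡ r ℚ.* a ℚ.- r ℚ.* b
    lem = solve 3 (λ r a b → r :* (a :- b) := r :* a :- r :* b) refl

  0ℝ 1ℝ : ℝ
  0ℝ = ι 0ℚ
  1ℝ = ι 1ℚ

module Complex where

  open ≡ using (refl)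
  open Real using (ℝ; seq; 0ℝ; 1ℝ)
  open ℚ-Solver.+-*-Solver using (solve; _:=_; _:+_; _:*_; _:-_; :-_; con)

  ℂ : Set
  ℂ = ℝ × ℝ

  infix  4 _≈_
  infixl 6 _+_
  infixl 7 _*_
  infix  8 -_

  _≈_ : ℂ → ℂ → Set
  (a , b) ≈ (c , d) = a Real.≈ c × b Real.≈ d

  _+_ _*_ : ℂ → ℂ → ℂ
  (a , b) + (c , d) = a Real.+ c , b Real.+ d
  (a , b) * (c , d) = a Real.* c Real.+ Real.- (b Real.* d) , a Real.* d Real.+ b Real.* c

  -_ : ℂ → ℂ
  - (a , b) = Real.- a , Real.- b

  0ℂ 1ℂ : ℂ
  0ℂ = 0ℝ , 0ℝ
  1ℂ = 1ℝ , 0ℝ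

  commutativeRing : CommutativeRing 0ℓ 0ℓ
  commutativeRing = record
    { Carrier = ℂ
    ; _≈_ = _≈_
    ; _+_ = _+_
    ; _*_ = _*_
    ; -_ = -_
    ; 0# = 0ℂ
    ; 1# = 1ℂ
    ; isCommutativeRing = record
      { isRing = record
        { +-isAbelianGroup = record
          { isGroup = record
            { isMonoid = record
              { isSemigroup = record
                { isMagma = record
                  { isEquivalence = record
                    { refl = λ {x} → Real.≈-refl {proj₁ x} , Real.≈-refl {proj₂ x}
                    ; sym = λ {x} {y} (p , q) →
                        Real.≈-sym {proj₁ x} {proj₁ y} p , Real.≈-sym {proj₂ x} {proj₂ y} q
                    ; trans = λ {x} {y} {z} (p , q) (r , s) →
                        Real.≈-trans {proj₁ x} {proj₁ y} {proj₁ z} p r ,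
                        Real.≈-trans {proj₂ x} {proj₂ y} {proj₂ z} q s
                    }
                  ; ∙-cong = λ {x} {y} {u} {v} → +-cong {x} {y} {u} {v}
                  }
                ; assoc = λ x y z →
                    pointwise {(x + y) + z} {x + (y + z)}
                      (λ n → ℚₚ.+-assoc (re x n) (re y n) (re z n))
                      (λ n → ℚₚ.+-assoc (im x n) (im y n) (im z n))
                }
              ; identity =
                  (λ x → pointwise {0ℂ + x} {x}
                    (λ n → ℚₚ.+-identityˡ (re x n)) (λ n → ℚₚ.+-identityˡ (im x n))) ,
                  (λ x → pointwise {x + 0ℂ} {x}
                    (λ n → ℚₚ.+-identityʳ (re x n)) (λ n → ℚₚ.+-identityʳ (im x n)))
              }
            ; inverse =
                (λ x → pointwise { - x + x} {0ℂ}
                  (λ n → ℚₚ.+-inverseˡ (re x n)) (λ n → ℚₚ.+-inverseˡ (im x n))) ,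
                (λ x → pointwise {x + - x} {0ℂ}
                  (λ n → ℚₚ.+-inverseʳ (re x n)) (λ n → ℚₚ.+-inverseʳ (im x n)))
            ; ⁻¹-cong = λ {x} {y} (p , q) →
                Real.-‿cong {proj₁ x} {proj₁ y} p , Real.-‿cong {proj₂ x} {proj₂ y} q
            }
          ; comm = λ x y → pointwise {x + y} {y + x}
              (λ n → ℚₚ.+-comm (re x n) (re y n)) (λ n → ℚₚ.+-comm (im x n) (im y n))
          }
        ; *-cong = λ {x} {y} {u} {v} → *-cong {x} {y} {u} {v}
        ; *-assoc = *-assoc
        ; *-identity =
            (λ x → pointwise {1ℂ * x} {x}
              (λ n → 1*-re (re x n) (im x n)) (λ n → 1*-im (re x n) (im x n))) ,
            (λ x → pointwise {x * 1ℂ} {x}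
              (λ n → *1-re (re x n) (im x n)) (λ n → *1-im (re x n) (im x n)))
        ; distrib =
            (λ x y z → pointwise {x * (y + z)} {x * y + x * z}
              (λ n → distribˡ-re (re x n) (im x n) (re y n) (im y n) (re z n) (im z n))
              (λ n → distribˡ-im (re x n) (im x n) (re y n) (im y n) (re z n) (im z n))) ,
            (λ x y z → pointwise {(y + z) * x} {y * x + z * x}
              (λ n → distribʳ-re (re x n) (im x n) (re y n) (im y n) (re z n) (im z n))
              (λ n → distribʳ-im (re x n) (im x n) (re y n) (im y n) (re z n) (im z n)))
        }
      ; *-comm = λ x y → pointwise {x * y} {y * x}
          (λ n → comm-re (re x n) (im x n) (re y n) (im y n))
          (λ n → comm-im (re x n) (im x n) (re y n) (im y n))
      }
    }
    where
    re im : ℂ → ℕ → ℚ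
    re (a , b) = seq a
    im (a , b) = seq b

    pointwise : ∀ {x y} → re x ≗ re y → im x ≗ im y → x ≈ y
    pointwise {a , b} {c , d} p q = Real.≈-pointwise {a} {c} p , Real.≈-pointwise {b} {d} q

    +-cong : ∀ {x y u v} → x ≈ y → u ≈ v → x + u ≈ y + v
    +-cong {a , b} {c , d} {e , f} {g , h} (p , q) (r , s) =
      Real.+-cong {a} {c} {e} {g} p r , Real.+-cong {b} {d} {f} {h} q s

    *-cong : ∀ {x y u v} → x ≈ y → u ≈ v → x * u ≈ y * v
    *-cong {a , b} {c , d} {e , f} {g , h} (p , q) (r , s) =
      Real.+-cong {a Real.* e} {c Real.* g} {Real.- (b Real.* f)} {Real.- (d Real.* h)}
        (Real.*-cong {a} {c} {e} {g} p r)
        (Real.-‿cong {b Real.* f} {d Real.* h} (Real.*-cong {b} {d} {f} {h} q s)) ,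
      Real.+-cong {a Real.* f} {c Real.* h} {b Real.* e} {d Real.* g}
        (Real.*-cong {a} {c} {f} {h} p s) (Real.*-cong {b} {d} {e} {g} q r)

    assoc-re : ∀ a b c d e f →
      (a ℚ.* c ℚ.+ ℚ.- (b ℚ.* d)) ℚ.* e ℚ.+ ℚ.- ((a ℚ.* d ℚ.+ b ℚ.* c) ℚ.* f) ≡
      a ℚ.* (c ℚ.* e ℚ.+ ℚ.- (d ℚ.* f)) ℚ.+ ℚ.- (b ℚ.* (c ℚ.* f ℚ.+ d ℚ.* e))
    assoc-re = solve 6 (λ a b c d e f →
      (a :* c :+ :- (b :* d)) :* e :+ :- ((a :* d :+ b :* c) :* f) :=
      a :* (c :* e :+ :- (d :* f)) :+ :- (b :* (c :* f :+ d :* e))) refl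

    assoc-im : ∀ a b c d e f →
      (a ℚ.* c ℚ.+ ℚ.- (b ℚ.* d)) ℚ.* f ℚ.+ (a ℚ.* d ℚ.+ b ℚ.* c) ℚ.* e ≡
      a ℚ.* (c ℚ.* f ℚ.+ d ℚ.* e) ℚ.+ b ℚ.* (c ℚ.* e ℚ.+ ℚ.- (d ℚ.* f))
    assoc-im = solve 6 (λ a b c d e f →
      (a :* c :+ :- (b :* d)) :* f :+ (a :* d :+ b :* c) :* e :=
      a :* (c :* f :+ d :* e) :+ b :* (c :* e :+ :- (d :* f))) refl

    *-assoc : ∀ x y z → (x * y) * z ≈ x * (y * z)
    *-assoc x y z = pointwise {(x * y) * z} {x * (y * z)}
      (λ n → assoc-re (re x n) (im x n) (re y n) (im y n) (re z n) (im z n))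
      (λ n → assoc-im (re x n) (im x n) (re y n) (im y n) (re z n) (im z n))

    1*-re : ∀ a b → 1ℚ ℚ.* a ℚ.+ ℚ.- (0ℚ ℚ.* b) ≡ a
    1*-re = solve 2 (λ a b → con 1ℚ :* a :+ :- (con 0ℚ :* b) := a) refl

    1*-im : ∀ a b → 1ℚ ℚ.* b ℚ.+ 0ℚ ℚ.* a ≡ b
    1*-im = solve 2 (λ a b → con 1ℚ :* b :+ con 0ℚ :* a := b) refl

    *1-re : ∀ a b → a ℚ.* 1ℚ ℚ.+ ℚ.- (b ℚ.* 0ℚ) ≡ a
    *1-re = solve 2 (λ a b → a :* con 1ℚ :+ :- (b :* con 0ℚ) := a) refl

    *1-im : ∀ a b → a ℚ.* 0ℚ ℚ.+ b ℚ.* 1ℚ ≡ b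
    *1-im = solve 2 (λ a b → a :* con 0ℚ :+ b :* con 1ℚ := b) refl

    distribˡ-re : ∀ a b c d e f →
      a ℚ.* (c ℚ.+ e) ℚ.+ ℚ.- (b ℚ.* (d ℚ.+ f)) ≡
      (a ℚ.* c ℚ.+ ℚ.- (b ℚ.* d)) ℚ.+ (a ℚ.* e ℚ.+ ℚ.- (b ℚ.* f))
    distribˡ-re = solve 6 (λ a b c d e f →
      a :* (c :+ e) :+ :- (b :* (d :+ f)) :=
      (a :* c :+ :- (b :* d)) :+ (a :* e :+ :- (b :* f))) refl

    distribˡ-im : ∀ a b c d e f →
      a ℚ.* (d ℚ.+ f) ℚ.+ b ℚ.* (c ℚ.+ e) ≡
      (a ℚ.* d ℚ.+ b ℚ.* c) ℚ.+ (a ℚ.* f ℚ.+ b ℚ.* e)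
    distribˡ-im = solve 6 (λ a b c d e f →
      a :* (d :+ f) :+ b :* (c :+ e) :=
      (a :* d :+ b :* c) :+ (a :* f :+ b :* e)) refl

    distribʳ-re : ∀ a b c d e f →
      (c ℚ.+ e) ℚ.* a ℚ.+ ℚ.- ((d ℚ.+ f) ℚ.* b) ≡
      (c ℚ.* a ℚ.+ ℚ.- (d ℚ.* b)) ℚ.+ (e ℚ.* a ℚ.+ ℚ.- (f ℚ.* b))
    distribʳ-re = solve 6 (λ a b c d e f →
      (c :+ e) :* a :+ :- ((d :+ f) :* b) :=
      (c :* a :+ :- (d :* b)) :+ (e :* a :+ :- (f :* b))) refl

    distribʳ-im : ∀ a b c d e f →
      (c ℚ.+ e) ℚ.* b ℚ.+ (d ℚ.+ f) ℚ.* a ≡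
      (c ℚ.* b ℚ.+ d ℚ.* a) ℚ.+ (e ℚ.* b ℚ.+ f ℚ.* a)
    distribʳ-im = solve 6 (λ a b c d e f →
      (c :+ e) :* b :+ (d :+ f) :* a :=
      (c :* b :+ d :* a) :+ (e :* b :+ f :* a)) refl

    comm-re : ∀ a b c d → a ℚ.* c ℚ.+ ℚ.- (b ℚ.* d) ≡ c ℚ.* a ℚ.+ ℚ.- (d ℚ.* b)
    comm-re = solve 4 (λ a b c d →
      a :* c :+ :- (b :* d) := c :* a :+ :- (d :* b)) refl

    comm-im : ∀ a b c d → a ℚ.* d ℚ.+ b ℚ.* c ≡ c ℚ.* b ℚ.+ d ℚ.* a
    comm-im = solve 4 (λ a b c d →
      a :* d :+ b :* c := c :* b :+ d :* a) refl

-- All graded algebras here are commutative; K is used with K = ℂ.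
record GradedAlgebra {c ℓ : Level} (K : CommutativeRing c ℓ) (a ℓa h : Level)
                     : Set (c ⊔ ℓ ⊔ lsuc (a ⊔ ℓa ⊔ h)) where
  private module K = CommutativeRing K
  field
    commutativeRing : CommutativeRing a ℓa
  open CommutativeRing commutativeRing public
  open RawMonoidDefs +-rawMonoid public using (sum)
  field
    η                   : K.Carrier → Carrier
    η-isRingHomomorphism : IsRingHomomorphism K.rawRing rawRing η

    -- Homogeneous k is membership in the graded piece A_k.
    Homogeneous : ℕ → Carrier → Set h
    homogeneous-resp : ∀ {k x y} → x ≈ y → Homogeneous k x → Homogeneous k y
    homogeneous-0#   : ∀ {k} → Homogeneous k 0#
    homogeneous-+    : ∀ {k x y} → Homogeneous k x → Homogeneous k y → Homogeneous k (x + y)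
    homogeneous-*    : ∀ {j k x y} → Homogeneous j x → Homogeneous k y →
                       Homogeneous (j ℕ.+ k) (x * y)
    homogeneous-η    : ∀ c → Homogeneous 0 (η c)

    -- A is the direct sum of the A_k.
    decompose   : ∀ x → ∃[ N ] Σ[ y ∈ Vector Carrier N ]
                  (∀ i → Homogeneous (toℕ i) (y i)) × x ≈ sum y
    independent : ∀ {N} (y : Vector Carrier N) → (∀ i → Homogeneous (toℕ i) (y i)) →
                  sum y ≈ 0# → ∀ i → y i ≈ 0#

  homogeneous-neg : ∀ {k x} → Homogeneous k x → Homogeneous k (- x)
  homogeneous-neg {k} {x} hx = homogeneous-resp η-1*x≈-x (homogeneous-* (homogeneous-η (K.- K.1#)) hx)
    where
    open IsRingHomomorphism η-isRingHomomorphism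
    open RingProperties ring using (-1*x≈-x)
    η-1*x≈-x : η (K.- K.1#) * x ≈ - x
    η-1*x≈-x = trans (*-congʳ (trans (-‿homo K.1#) (-‿cong 1#-homo))) (-1*x≈-x x)

  -- The pieces indexed by all integers: A_d = 0 for d < 0.
  Homogeneousℤ : ℤ → Carrier → Set (ℓa ⊔ h)
  Homogeneousℤ (+ k)      x = Lift ℓa (Homogeneous k x)
  Homogeneousℤ ℤ.-[1+ _ ] x = Lift h (x ≈ 0#)

module _ {c ℓ a ℓa h : Level} {K : CommutativeRing c ℓ} (A : GradedAlgebra K a ℓa h) where

  private module K = CommutativeRing K
  open GradedAlgebra A

  -- The K-subalgebra generated by a finite family.
  data Generated {m : ℕ} (g : Vector Carrier m) : Carrier → Set (c ⊔ a ⊔ ℓa) where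
    scalar    : ∀ c → Generated g (η c)
    generator : ∀ i → Generated g (g i)
    plus      : ∀ {x y} → Generated g x → Generated g y → Generated g (x + y)
    times     : ∀ {x y} → Generated g x → Generated g y → Generated g (x * y)
    resp      : ∀ {x y} → x ≈ y → Generated g x → Generated g y

  -- A₀ = K, and A is generated by finitely many elements of A₁.
  record StandardGraded : Set (c ⊔ ℓ ⊔ a ⊔ ℓa ⊔ h) where
    field
      η-injective   : ∀ {c d} → η c ≈ η d → c K.≈ d
      A₀⊆η          : ∀ {x} → Homogeneous 0 x → ∃[ c ] η c ≈ x
      size          : ℕ
      generators    : Vector Carrier size
      generators-A₁ : ∀ i → Homogeneous 1 (generators i)
      generates     : ∀ x → Generated generators x

  -- The ideal A_{>0}, as the additive span of the pieces of positive degree.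
  data A>0 : Carrier → Set (a ⊔ ℓa ⊔ h) where
    homogeneous : ∀ {k x} → Homogeneous (ℕ.suc k) x → A>0 x
    null        : A>0 0#
    plus        : ∀ {x y} → A>0 x → A>0 y → A>0 (x + y)
    resp        : ∀ {x y} → x ≈ y → A>0 x → A>0 y

  private
    open RingProperties ring
      using (-0#≈0#; -‿+-comm; -‿involutive; x[y-z]≈xy-xz)
    open CommutativeSemigroupProperties +-commutativeSemigroup
      using (interchange)
    module ≈-Reasoning = SetoidReasoning setoid

  A>0-neg : ∀ {x} → A>0 x → A>0 (- x)
  A>0-neg (homogeneous h) = homogeneous (homogeneous-neg h)
  A>0-neg null            = resp (sym -0#≈0#) null
  A>0-neg (plus p q)      = resp (-‿+-comm _ _) (plus (A>0-neg p) (A>0-neg q))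
  A>0-neg (resp e p)      = resp (-‿cong e) (A>0-neg p)

  A>0-* : ∀ r {x} → A>0 x → A>0 (r * x)
  A>0-* r (homogeneous {k} {x} hx) with decompose r
  ... | N , y , hy , r≈Σy = resp (*-congʳ (sym r≈Σy)) (sum*x y toℕ hy)
    where
    sum*x : ∀ {n} (y : Vector Carrier n) (d : Fin n → ℕ) →
            (∀ i → Homogeneous (d i) (y i)) → A>0 (sum y * x)
    sum*x {ℕ.zero}  y d hy = resp (sym (zeroˡ x)) null
    sum*x {ℕ.suc n} y d hy =
      resp (sym (distribʳ x (y Fin.zero) (sum (y ∘ Fin.suc))))
        (plus
          (homogeneous (subst (λ e → Homogeneous e (y Fin.zero * x)) (ℕₚ.+-suc (d Fin.zero) k)
            (homogeneous-* (hy Fin.zero) hx)))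
          (sum*x (y ∘ Fin.suc) (d ∘ Fin.suc) (hy ∘ Fin.suc)))
  A>0-* r null       = resp (sym (zeroʳ r)) null
  A>0-* r (plus p q) = resp (sym (distribˡ r _ _)) (plus (A>0-* r p) (A>0-* r q))
  A>0-* r (resp e p) = resp (*-congˡ e) (A>0-* r p)

  -- The residue field A / A_{>0}: the elements of A, up to equality modulo A_{>0}.
  residueField : LeftModule ring a (a ⊔ ℓa ⊔ h)
  residueField = record
    { Carrierᴹ = Carrier
    ; _≈ᴹ_ = _~_
    ; _+ᴹ_ = _+_
    ; _*ₗ_ = _*_
    ; 0ᴹ = 0#
    ; -ᴹ_ = -_
    ; isLeftModule = record
      { isLeftSemimodule = record
        { +ᴹ-isCommutativeMonoid = record
          { isMonoid = record
            { isSemigroup = record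
              { isMagma = record
                { isEquivalence = record
                  { refl = ≈⇒~ refl
                  ; sym = λ {x} {y} p → resp (-[x-y]≈y-x x y) (A>0-neg p)
                  ; trans = λ {x} {y} {z} p q → resp (telescope x y z) (plus p q)
                  }
                ; ∙-cong = λ {x} {y} {u} {v} p q → resp (regroup x y u v) (plus p q)
                }
              ; assoc = λ x y z → ≈⇒~ (+-assoc x y z)
              }
            ; identity = (λ x → ≈⇒~ (+-identityˡ x)) , (λ x → ≈⇒~ (+-identityʳ x))
            }
          ; comm = λ x y → ≈⇒~ (+-comm x y)
          }
        ; isPreleftSemimodule = record
          { *ₗ-cong = λ {r} {s} {x} {y} r≈s p →
              resp (trans (x[y-z]≈xy-xz r x y) (+-congˡ (-‿cong (*-congʳ r≈s)))) (A>0-* r p)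
          ; *ₗ-zeroˡ = λ x → ≈⇒~ (zeroˡ x)
          ; *ₗ-distribʳ = λ x r s → ≈⇒~ (distribʳ x r s)
          ; *ₗ-identityˡ = λ x → ≈⇒~ (*-identityˡ x)
          ; *ₗ-assoc = λ r s x → ≈⇒~ (*-assoc r s x)
          ; *ₗ-zeroʳ = λ r → ≈⇒~ (zeroʳ r)
          ; *ₗ-distribˡ = λ r x y → ≈⇒~ (distribˡ r x y)
          }
        }
      ; -ᴹ‿cong = λ {x} {y} p → resp (sym (-‿+-comm x (- y))) (A>0-neg p)
      ; -ᴹ‿inverse = (λ x → ≈⇒~ (-‿inverseˡ x)) , (λ x → ≈⇒~ (-‿inverseʳ x))
      }
    }
    where
    _~_ : Carrier → Carrier → Set (a ⊔ ℓa ⊔ h)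
    x ~ y = A>0 (x - y)

    ≈⇒~ : ∀ {x y} → x ≈ y → x ~ y
    ≈⇒~ {x} {y} x≈y = resp (sym (trans (+-congʳ x≈y) (-‿inverseʳ y))) null

    -[x-y]≈y-x : ∀ x y → - (x - y) ≈ y - x
    -[x-y]≈y-x x y = begin
      - (x - y)     ≈⟨ -‿+-comm x (- y) ⟨
      - x + - - y   ≈⟨ +-congˡ (-‿involutive y) ⟩
      - x + y       ≈⟨ +-comm (- x) y ⟩
      y - x         ∎ where open ≈-Reasoning

    telescope : ∀ x y z → (x - y) + (y - z) ≈ x - z
    telescope x y z = begin
      (x - y) + (y - z)    ≈⟨ +-assoc x (- y) (y - z) ⟩
      x + (- y + (y - z))  ≈⟨ +-congˡ (+-assoc (- y) y (- z)) ⟨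
      x + ((- y + y) - z)  ≈⟨ +-congˡ (+-congʳ (-‿inverseˡ y)) ⟩
      x + (0# - z)         ≈⟨ +-congˡ (+-identityˡ (- z)) ⟩
      x - z                ∎ where open ≈-Reasoning

    regroup : ∀ x y u v → (x - y) + (u - v) ≈ (x + u) - (y + v)
    regroup x y u v = trans (interchange x (- y) u (- v)) (+-congˡ (-‿+-comm y v))

  -- The image of A_d in A / A_{>0}.
  InResidueDegree : ℕ → Carrier → Set (a ⊔ ℓa ⊔ h)
  InResidueDegree d x = ∃[ y ] Homogeneous d y × x ≈ᴹ y
    where open LeftModule residueField

  free : ℕ → LeftModule ring a ℓa
  free n = record
    { Carrierᴹ = Vector Carrier n
    ; _≈ᴹ_ = λ u v → ∀ i → u i ≈ v i
    ; _+ᴹ_ = λ u v i → u i + v i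
    ; _*ₗ_ = λ r v i → r * v i
    ; 0ᴹ = λ _ → 0#
    ; -ᴹ_ = λ v i → - v i
    ; isLeftModule = record
      { isLeftSemimodule = record
        { +ᴹ-isCommutativeMonoid = record
          { isMonoid = record
            { isSemigroup = record
              { isMagma = record
                { isEquivalence = record
                  { refl = λ i → refl
                  ; sym = λ p i → sym (p i)
                  ; trans = λ p q i → trans (p i) (q i)
                  }
                ; ∙-cong = λ p q i → +-cong (p i) (q i)
                }
              ; assoc = λ u v w i → +-assoc (u i) (v i) (w i)
              }
            ; identity = (λ v i → +-identityˡ (v i)) , (λ v i → +-identityʳ (v i))
            }
          ; comm = λ u v i → +-comm (u i) (v i)
          }
        ; isPreleftSemimodule = record
          { *ₗ-cong = λ p q i → *-cong p (q i)
          ; *ₗ-zeroˡ = λ v i → zeroˡ (v i)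
          ; *ₗ-distribʳ = λ v r s i → distribʳ (v i) r s
          ; *ₗ-identityˡ = λ v i → *-identityˡ (v i)
          ; *ₗ-assoc = λ r s v i → *-assoc r s (v i)
          ; *ₗ-zeroʳ = λ r i → zeroʳ r
          ; *ₗ-distribˡ = λ r u v i → distribˡ r (u i) (v i)
          }
        }
      ; -ᴹ‿cong = λ p i → -‿cong (p i)
      ; -ᴹ‿inverse = (λ v i → -‿inverseˡ (v i)) , (λ v i → -‿inverseʳ (v i))
      }
    }

  -- The degree d piece of the graded free module ⊕ⱼ A(-sⱼ), where A(-s)_d = A_{d-s}.
  InDegree : ∀ {n} → Vector ℕ n → ℕ → Vector Carrier n → Set (ℓa ⊔ h)
  InDegree s d v = ∀ j → Homogeneousℤ (d ℤ.⊖ s j) (v j)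

  -- ⋯ → F₂ → F₁ → F₀ → A / A_{>0} → 0 exact, with Fᵢ = ⊕ⱼ A(-shift i j)
  -- of finite rank (A is finitely generated over K).
  record GradedFreeResolution : Set (c ⊔ ℓ ⊔ a ⊔ ℓa ⊔ h) where
    private
      module F (i : ℕ) = LeftModule (free i)
      module R = LeftModule residueField
    field
      rank  : ℕ → ℕ
      shift : ∀ i → Vector ℕ (rank i)

      ∂        : ∀ i → F.Carrierᴹ (rank (ℕ.suc i)) → F.Carrierᴹ (rank i)
      ∂-linear : ∀ i → IsLeftModuleHomomorphism
                         (F.rawLeftModule (rank (ℕ.suc i))) (F.rawLeftModule (rank i)) (∂ i)
      ∂-graded : ∀ i {d v} → InDegree (shift (ℕ.suc i)) d v → InDegree (shift i) d (∂ i v)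

      ε        : F.Carrierᴹ (rank 0) → R.Carrierᴹ
      ε-linear : IsLeftModuleHomomorphism (F.rawLeftModule (rank 0)) R.rawLeftModule ε
      ε-graded : ∀ {d v} → InDegree (shift 0) d v → InResidueDegree d (ε v)

      ε-surjective : ∀ x → ∃[ v ] ε v R.≈ᴹ x
      exact₀       : ∀ v → ε v R.≈ᴹ R.0ᴹ ⇔ (∃[ w ] F._≈ᴹ_ (rank 0) (∂ 0 w) v)
      exact        : ∀ i v → F._≈ᴹ_ (rank i) (∂ i v) (F.0ᴹ (rank i)) ⇔
                             (∃[ w ] F._≈ᴹ_ (rank (ℕ.suc i)) (∂ (ℕ.suc i) w) v)

  -- Fᵢ = A(-i)^{rank i}.
  Linear : GradedFreeResolution → Set
  Linear F = ∀ i j → shift i j ≡ i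
    where open GradedFreeResolution F

  Koszul : Set (c ⊔ ℓ ⊔ a ⊔ ℓa ⊔ h)
  Koszul = StandardGraded × (Σ[ F ∈ GradedFreeResolution ] Linear F)

-- The monoid algebra K[M], with t^x · t^y = t^(x∙y), graded by a
-- homomorphism M → ℕ.

module MonoidAlgebra {c ℓ m ℓm : Level} (K : CommutativeRing c ℓ)
  (M : CommutativeMonoid m ℓm)
  (_≟_ : Decidable (CommutativeMonoid._≈_ M))
  (degree : CommutativeMonoid.Carrier M → ℕ)
  (degree-isMonoidHomomorphism :
    IsMonoidHomomorphism (CommutativeMonoid.rawMonoid M) ℕ.+-0-rawMonoid degree)
  where

  private
    open ≡ using (refl; sym; trans)
    module K = CommutativeRing K
    module M = CommutativeMonoid M
    module degree = IsMonoidHomomorphism degree-isMonoidHomomorphism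
    open K using () renaming (Carrier to k)
    open RingProperties K.ring using (-0#≈0#; -‿+-comm; -‿distribˡ-*; x∙y⁻¹≈ε⇒x≈y)
    open CommutativeSemigroupProperties K.+-commutativeSemigroup using (interchange)
    open CommutativeSemigroupProperties K.*-commutativeSemigroup using ()
      renaming (x∙yz≈y∙xz to *-x∙yz≈y∙xz)
    module ≈-Reasoning = SetoidReasoning K.setoid

  -- A formal linear combination Σ aᵢ t^{xᵢ}; exponents may repeat, and equality
  -- compares the total coefficient of each exponent.
  Carrier : Set (c ⊔ m)
  Carrier = List (k × M.Carrier)

  infix  4 _≈_
  infixl 6 _+_
  infixl 7 _*_
  infix  8 -_

  -- Σ aᵢ t^{xᵢ} ↦ Σ aᵢ φ(xᵢ)
  lin : (M.Carrier → k) → Carrier → k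
  lin φ []             = K.0#
  lin φ ((a , x) ∷ xs) = a K.* φ x K.+ lin φ xs

  δ : M.Carrier → M.Carrier → k
  δ x y = if does (x ≟ y) then K.1# else K.0#

  coefficient : M.Carrier → Carrier → k
  coefficient x = lin (δ x)

  _≈_ : Carrier → Carrier → Set (ℓ ⊔ m)
  xs ≈ ys = ∀ x → coefficient x xs K.≈ coefficient x ys

  _+_ _*_ : Carrier → Carrier → Carrier
  xs + ys = xs ++ ys

  [] * ys             = []
  ((a , x) ∷ xs) * ys = map (λ (b , y) → a K.* b , x M.∙ y) ys + xs * ys

  -_ : Carrier → Carrier
  - xs = map (λ (a , x) → K.- a , x) xs

  0# 1# : Carrier
  0# = []
  1# = (K.1# , M.ε) ∷ []

  Congruent : (M.Carrier → k) → Set (ℓ ⊔ m ⊔ ℓm)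
  Congruent φ = ∀ {x y} → x M.≈ y → φ x K.≈ φ y

  δ-1 : ∀ {x y} → x M.≈ y → δ x y K.≈ K.1#
  δ-1 {x} {y} x≈y with x ≟ y
  ... | yes _  = K.refl
  ... | no x≉y = contradiction x≈y x≉y

  δ-0 : ∀ {x y} → ¬ x M.≈ y → δ x y K.≈ K.0#
  δ-0 {x} {y} x≉y with x ≟ y
  ... | yes x≈y = contradiction x≈y x≉y
  ... | no _    = K.refl

  δ-cong : ∀ x → Congruent (δ x)
  δ-cong x {y} {z} y≈z with x ≟ y
  ... | yes x≈y = K.sym (δ-1 (M.trans x≈y y≈z))
  ... | no x≉y  = K.sym (δ-0 (λ x≈z → x≉y (M.trans x≈z (M.sym y≈z))))

  lin-cong : ∀ {φ ψ} → (∀ x → φ x K.≈ ψ x) → ∀ xs → lin φ xs K.≈ lin ψ xs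
  lin-cong e []             = K.refl
  lin-cong e ((a , x) ∷ xs) = K.+-cong (K.*-congˡ (e x)) (lin-cong e xs)

  lin-+ : ∀ φ xs ys → lin φ (xs + ys) K.≈ lin φ xs K.+ lin φ ys
  lin-+ φ []             ys = K.sym (K.+-identityˡ _)
  lin-+ φ ((a , x) ∷ xs) ys = K.trans (K.+-congˡ (lin-+ φ xs ys)) (K.sym (K.+-assoc _ _ _))

  lin-neg : ∀ φ xs → lin φ (- xs) K.≈ K.- lin φ xs
  lin-neg φ []             = K.sym -0#≈0#
  lin-neg φ ((a , x) ∷ xs) =
    K.trans (K.+-cong (K.sym (-‿distribˡ-* a (φ x))) (lin-neg φ xs)) (-‿+-comm _ _)

  lin-0 : ∀ xs → lin (λ _ → K.0#) xs K.≈ K.0#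
  lin-0 []             = K.refl
  lin-0 ((a , x) ∷ xs) = K.trans (K.+-cong (K.zeroʳ a) (lin-0 xs)) (K.+-identityˡ K.0#)

  lin-add : ∀ φ ψ xs → lin (λ x → φ x K.+ ψ x) xs K.≈ lin φ xs K.+ lin ψ xs
  lin-add φ ψ []             = K.sym (K.+-identityˡ _)
  lin-add φ ψ ((a , x) ∷ xs) =
    K.trans (K.+-cong (K.distribˡ a (φ x) (ψ x)) (lin-add φ ψ xs)) (interchange _ _ _ _)

  lin-scale : ∀ b φ xs → lin (λ x → b K.* φ x) xs K.≈ b K.* lin φ xs
  lin-scale b φ []             = K.sym (K.zeroʳ b)
  lin-scale b φ ((a , x) ∷ xs) =
    K.trans (K.+-cong (*-x∙yz≈y∙xz a b (φ x)) (lin-scale b φ xs)) (K.sym (K.distribˡ b _ _))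

  lin-swap : ∀ (f : M.Carrier → M.Carrier → k) xs ys →
             lin (λ x → lin (f x) ys) xs K.≈ lin (λ y → lin (λ x → f x y) xs) ys
  lin-swap f []             ys = K.sym (lin-0 ys)
  lin-swap f ((a , x) ∷ xs) ys = begin
    a K.* lin (f x) ys K.+ lin (λ z → lin (f z) ys) xs
      ≈⟨ K.+-cong (K.sym (lin-scale a (f x) ys)) (lin-swap f xs ys) ⟩
    lin (λ y → a K.* f x y) ys K.+ lin (λ y → lin (λ z → f z y) xs) ys
      ≈⟨ lin-add (λ y → a K.* f x y) (λ y → lin (λ z → f z y) xs) ys ⟨
    lin (λ y → a K.* f x y K.+ lin (λ z → f z y) xs) ys ∎
    where open ≈-Reasoning

  lin-* : ∀ φ xs ys → lin φ (xs * ys) K.≈ lin (λ x → lin (λ y → φ (x M.∙ y)) ys) xs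
  lin-* φ []             ys = K.refl
  lin-* φ ((a , x) ∷ xs) ys =
    K.trans (lin-+ φ (map (λ (b , y) → a K.* b , x M.∙ y) ys) (xs * ys)) (K.+-cong (term ys) (lin-* φ xs ys))
    where
    term : ∀ ys → lin φ (map (λ (b , y) → a K.* b , x M.∙ y) ys) K.≈
                  a K.* lin (λ y → φ (x M.∙ y)) ys
    term []             = K.sym (K.zeroʳ a)
    term ((b , y) ∷ ys) =
      K.trans (K.+-cong (K.*-assoc a b _) (term ys)) (K.sym (K.distribˡ a _ _))

  remove : M.Carrier → Carrier → Carrier
  remove x []             = []
  remove x ((b , y) ∷ ys) = if does (x ≟ y) then remove x ys else (b , y) ∷ remove x ys

  length-remove : ∀ x ys → length (remove x ys) ℕ.≤ length ys
  length-remove x []             = ℕ.z≤n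
  length-remove x ((b , y) ∷ ys) with x ≟ y
  ... | yes _ = ℕₚ.m≤n⇒m≤1+n (length-remove x ys)
  ... | no  _ = ℕ.s≤s (length-remove x ys)

  lin-remove : ∀ {φ} → Congruent φ → ∀ x ys →
               lin φ ys K.≈ coefficient x ys K.* φ x K.+ lin φ (remove x ys)
  lin-remove {φ} φ-cong x [] = K.sym (K.trans (K.+-identityʳ _) (K.zeroˡ (φ x)))
  lin-remove {φ} φ-cong x ((b , y) ∷ ys) with x ≟ y
  ... | yes x≈y = begin
    b K.* φ y K.+ lin φ ys
      ≈⟨ K.+-cong (K.*-cong (K.sym (K.*-identityʳ b)) (φ-cong (M.sym x≈y))) (lin-remove φ-cong x ys) ⟩
    b K.* K.1# K.* φ x K.+ (coefficient x ys K.* φ x K.+ lin φ (remove x ys))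
      ≈⟨ K.+-assoc _ _ _ ⟨
    b K.* K.1# K.* φ x K.+ coefficient x ys K.* φ x K.+ lin φ (remove x ys)
      ≈⟨ K.+-congʳ (K.distribʳ (φ x) _ _) ⟨
    (b K.* K.1# K.+ coefficient x ys) K.* φ x K.+ lin φ (remove x ys) ∎
    where open ≈-Reasoning
  ... | no x≉y = begin
    b K.* φ y K.+ lin φ ys
      ≈⟨ K.+-congˡ (lin-remove φ-cong x ys) ⟩
    b K.* φ y K.+ (coefficient x ys K.* φ x K.+ lin φ (remove x ys))
      ≈⟨ K.+-assoc _ _ _ ⟨
    b K.* φ y K.+ coefficient x ys K.* φ x K.+ lin φ (remove x ys)
      ≈⟨ K.+-congʳ (K.+-comm _ _) ⟩
    coefficient x ys K.* φ x K.+ b K.* φ y K.+ lin φ (remove x ys)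
      ≈⟨ K.+-assoc _ _ _ ⟩
    coefficient x ys K.* φ x K.+ (b K.* φ y K.+ lin φ (remove x ys))
      ≈⟨ K.+-congʳ (K.*-congʳ (K.trans (K.+-congʳ (K.zeroʳ b)) (K.+-identityˡ _))) ⟨
    (b K.* K.0# K.+ coefficient x ys) K.* φ x K.+ (b K.* φ y K.+ lin φ (remove x ys)) ∎
    where open ≈-Reasoning

  lin-null : ∀ {φ} → Congruent φ → ∀ xs → xs ≈ 0# → lin φ xs K.≈ K.0#
  lin-null {φ} φ-cong xs = go (length xs) xs ℕₚ.≤-refl
    where
    drop : ∀ {ψ} → Congruent ψ → ∀ x ys → ys ≈ 0# → lin ψ ys K.≈ lin ψ (remove x ys)
    drop {ψ} ψ-cong x ys ys≈0 = K.trans (lin-remove ψ-cong x ys)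
      (K.trans (K.+-congʳ (K.trans (K.*-congʳ (ys≈0 x)) (K.zeroˡ (ψ x)))) (K.+-identityˡ _))

    head-removed : ∀ a x ys → length (remove x ((a , x) ∷ ys)) ℕ.≤ length ys
    head-removed a x ys with x ≟ x
    ... | yes _  = length-remove x ys
    ... | no x≉x = contradiction M.refl x≉x

    go : ∀ n xs → length xs ℕ.≤ n → xs ≈ 0# → lin φ xs K.≈ K.0#
    go n       []                  _           _    = K.refl
    go (suc n) xs@((a , x) ∷ ys) (ℕ.s≤s l) xs≈0 =
      K.trans (drop φ-cong x xs xs≈0)
        (go n (remove x xs) (ℕₚ.≤-trans (head-removed a x ys) l)
          (λ z → K.trans (K.sym (drop (δ-cong z) x xs xs≈0)) (xs≈0 z)))

  lin-resp : ∀ {φ} → Congruent φ → ∀ {xs ys} → xs ≈ ys → lin φ xs K.≈ lin φ ys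
  lin-resp {φ} φ-cong {xs} {ys} xs≈ys = x∙y⁻¹≈ε⇒x≈y _ _
    (K.trans (K.sym (difference φ))
      (lin-null φ-cong (xs + - ys) λ z →
        K.trans (difference (δ z)) (K.trans (K.+-congʳ (xs≈ys z)) (K.-‿inverseʳ _))))
    where
    difference : ∀ ψ → lin ψ (xs + - ys) K.≈ lin ψ xs K.- lin ψ ys
    difference ψ = K.trans (lin-+ ψ xs (- ys)) (K.+-congˡ (lin-neg ψ ys))

  lin-congruent : ∀ {f : M.Carrier → M.Carrier → k} → (∀ {x y} → x M.≈ y → ∀ z → f x z K.≈ f y z) →
                  ∀ zs → Congruent (λ x → lin (f x) zs)
  lin-congruent e zs x≈y = lin-cong (e x≈y) zs

  *-cong : ∀ {xs ys us vs} → xs ≈ ys → us ≈ vs → xs * us ≈ ys * vs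
  *-cong {xs} {ys} {us} {vs} xs≈ys us≈vs z = begin
    coefficient z (xs * us)                        ≈⟨ lin-* (δ z) xs us ⟩
    lin (λ x → lin (λ u → δ z (x M.∙ u)) us) xs
      ≈⟨ lin-resp (lin-congruent (λ e u → δ-cong z (M.∙-congʳ e)) us) {xs} {ys} xs≈ys ⟩
    lin (λ x → lin (λ u → δ z (x M.∙ u)) us) ys
      ≈⟨ lin-cong (λ x → lin-resp (λ e → δ-cong z (M.∙-congˡ e)) {us} {vs} us≈vs) ys ⟩
    lin (λ x → lin (λ u → δ z (x M.∙ u)) vs) ys    ≈⟨ lin-* (δ z) ys vs ⟨
    coefficient z (ys * vs)                        ∎
    where open ≈-Reasoning

  *-comm : ∀ xs ys → xs * ys ≈ ys * xs
  *-comm xs ys z = begin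
    coefficient z (xs * ys)                        ≈⟨ lin-* (δ z) xs ys ⟩
    lin (λ x → lin (λ y → δ z (x M.∙ y)) ys) xs    ≈⟨ lin-swap (λ x y → δ z (x M.∙ y)) xs ys ⟩
    lin (λ y → lin (λ x → δ z (x M.∙ y)) xs) ys
      ≈⟨ lin-cong (λ y → lin-cong (λ x → δ-cong z (M.comm x y)) xs) ys ⟩
    lin (λ y → lin (λ x → δ z (y M.∙ x)) xs) ys    ≈⟨ lin-* (δ z) ys xs ⟨
    coefficient z (ys * xs)                        ∎
    where open ≈-Reasoning

  *-assoc : ∀ xs ys zs → (xs * ys) * zs ≈ xs * (ys * zs)
  *-assoc xs ys zs w = begin
    coefficient w ((xs * ys) * zs)
      ≈⟨ lin-* (δ w) (xs * ys) zs ⟩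
    lin (λ u → lin (λ z → δ w (u M.∙ z)) zs) (xs * ys)
      ≈⟨ lin-* (λ u → lin (λ z → δ w (u M.∙ z)) zs) xs ys ⟩
    lin (λ x → lin (λ y → lin (λ z → δ w ((x M.∙ y) M.∙ z)) zs) ys) xs
      ≈⟨ lin-cong (λ x → lin-cong (λ y → lin-cong (λ z → δ-cong w (M.assoc x y z)) zs) ys) xs ⟩
    lin (λ x → lin (λ y → lin (λ z → δ w (x M.∙ (y M.∙ z))) zs) ys) xs
      ≈⟨ lin-cong (λ x → lin-* (λ u → δ w (x M.∙ u)) ys zs) xs ⟨
    lin (λ x → lin (λ u → δ w (x M.∙ u)) (ys * zs)) xs
      ≈⟨ lin-* (δ w) xs (ys * zs) ⟨
    coefficient w (xs * (ys * zs)) ∎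
    where open ≈-Reasoning

  *-identityˡ : ∀ xs → 1# * xs ≈ xs
  *-identityˡ xs z = begin
    coefficient z (1# * xs)                                  ≈⟨ lin-* (δ z) 1# xs ⟩
    K.1# K.* lin (λ x → δ z (M.ε M.∙ x)) xs K.+ K.0#         ≈⟨ K.+-identityʳ _ ⟩
    K.1# K.* lin (λ x → δ z (M.ε M.∙ x)) xs                  ≈⟨ K.*-identityˡ _ ⟩
    lin (λ x → δ z (M.ε M.∙ x)) xs
      ≈⟨ lin-cong (λ x → δ-cong z (M.identityˡ x)) xs ⟩
    coefficient z xs                                         ∎
    where open ≈-Reasoning

  distribʳ : ∀ xs ys zs → (ys + zs) * xs ≈ ys * xs + zs * xs
  distribʳ xs ys zs w = begin
    coefficient w ((ys + zs) * xs)                      ≈⟨ lin-* (δ w) (ys + zs) xs ⟩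
    lin φ (ys + zs)                                     ≈⟨ lin-+ φ ys zs ⟩
    lin φ ys K.+ lin φ zs
      ≈⟨ K.+-cong (lin-* (δ w) ys xs) (lin-* (δ w) zs xs) ⟨
    coefficient w (ys * xs) K.+ coefficient w (zs * xs) ≈⟨ lin-+ (δ w) (ys * xs) (zs * xs) ⟨
    coefficient w (ys * xs + zs * xs)                   ∎
    where
    open ≈-Reasoning
    φ = λ y → lin (λ x → δ w (y M.∙ x)) xs

  commutativeRing : CommutativeRing (c ⊔ m) (ℓ ⊔ m)
  commutativeRing = record
    { Carrier = Carrier
    ; _≈_ = _≈_
    ; _+_ = _+_
    ; _*_ = _*_
    ; -_ = -_
    ; 0# = 0#
    ; 1# = 1#
    ; isCommutativeRing = record
      { isRing = record
        { +-isAbelianGroup = record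
          { isGroup = record
            { isMonoid = record
              { isSemigroup = record
                { isMagma = record
                  { isEquivalence = record
                    { refl = λ z → K.refl
                    ; sym = λ p z → K.sym (p z)
                    ; trans = λ p q z → K.trans (p z) (q z)
                    }
                  ; ∙-cong = λ {xs} {ys} {us} {vs} p q z →
                      K.trans (lin-+ (δ z) xs us)
                        (K.trans (K.+-cong (p z) (q z)) (K.sym (lin-+ (δ z) ys vs)))
                  }
                ; assoc = λ xs ys zs w → K.reflexive (cong (coefficient w) (++-assoc xs ys zs))
                }
              ; identity = (λ xs z → K.refl) ,
                           (λ xs z → K.reflexive (cong (coefficient z) (++-identityʳ xs)))
              }
            ; inverse =
                (λ xs z → K.trans (+-comm (- xs) xs z) (inverseʳ xs z)) , inverseʳ
            ; ⁻¹-cong = λ {xs} {ys} p z →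
                K.trans (lin-neg (δ z) xs)
                  (K.trans (K.-‿cong (p z)) (K.sym (lin-neg (δ z) ys)))
            }
          ; comm = +-comm
          }
        ; *-cong = λ {xs} {ys} {us} {vs} → *-cong {xs} {ys} {us} {vs}
        ; *-assoc = *-assoc
        ; *-identity = *-identityˡ ,
            (λ xs z → K.trans (*-comm xs 1# z) (*-identityˡ xs z))
        ; distrib =
            (λ xs ys zs w → begin
              coefficient w (xs * (ys + zs))
                ≈⟨ *-comm xs (ys + zs) w ⟩
              coefficient w ((ys + zs) * xs)
                ≈⟨ distribʳ xs ys zs w ⟩
              coefficient w (ys * xs + zs * xs)
                ≈⟨ lin-+ (δ w) (ys * xs) (zs * xs) ⟩
              coefficient w (ys * xs) K.+ coefficient w (zs * xs)
                ≈⟨ K.+-cong (*-comm ys xs w) (*-comm zs xs w) ⟩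
              coefficient w (xs * ys) K.+ coefficient w (xs * zs)
                ≈⟨ lin-+ (δ w) (xs * ys) (xs * zs) ⟨
              coefficient w (xs * ys + xs * zs) ∎) ,
            distribʳ
        }
      ; *-comm = *-comm
      }
    }
    where
    open ≈-Reasoning

    +-comm : ∀ xs ys → xs + ys ≈ ys + xs
    +-comm xs ys z = K.trans (lin-+ (δ z) xs ys)
      (K.trans (K.+-comm _ _) (K.sym (lin-+ (δ z) ys xs)))

    inverseʳ : ∀ xs → xs + - xs ≈ 0#
    inverseʳ xs z = K.trans (lin-+ (δ z) xs (- xs))
      (K.trans (K.+-congˡ (lin-neg (δ z) xs)) (K.-‿inverseʳ _))

  η : k → Carrier
  η a = (a , M.ε) ∷ []

  -- The degree d piece is spanned by the t^x with degree x ≡ d.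
  Homogeneous : ℕ → Carrier → Set (c ⊔ ℓ ⊔ m)
  Homogeneous d xs = ∃[ ys ] All (λ (a , x) → degree x ≡ d) ys × xs ≈ ys

  private
    module A = CommutativeRing commutativeRing
    module KSum = SumProperties K.+-commutativeMonoid
    open RawMonoidDefs A.+-rawMonoid using (sum)

  lin-sum : ∀ φ {N} (xs : Vector Carrier N) → lin φ (sum xs) K.≈ KSum.sum (λ i → lin φ (xs i))
  lin-sum φ {zero}  xs = K.refl
  lin-sum φ {suc N} xs = K.trans (lin-+ φ (xs Fin.zero) (sum (xs ∘ Fin.suc)))
    (K.+-congˡ (lin-sum φ (xs ∘ Fin.suc)))

  sum-single : ∀ {N} (f : Vector k N) i → (∀ j → ¬ j ≡ i → f j K.≈ K.0#) → KSum.sum f K.≈ f i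
  sum-single f Fin.zero others = K.trans (K.+-congˡ (sum-0 (f ∘ Fin.suc) (λ j → others (Fin.suc j) (λ ()))))
    (K.+-identityʳ _)
    where
    sum-0 : ∀ {N} (f : Vector k N) → (∀ j → f j K.≈ K.0#) → KSum.sum f K.≈ K.0#
    sum-0 {N} f f≈0 = K.trans (KSum.sum-cong-≋ f≈0) (KSum.sum-replicate-zero N)
  sum-single f (Fin.suc i) others =
    K.trans (K.+-cong (others Fin.zero (λ ()))
                      (sum-single (f ∘ Fin.suc) i
                        (λ j j≢i → others (Fin.suc j) (λ e → j≢i (Finₚ.suc-injective e)))))
      (K.+-identityˡ _)

  lin-supported : ∀ {φ d} ys → All (λ (a , x) → degree x ≡ d) ys →
                  (∀ x → degree x ≡ d → φ x K.≈ K.0#) → lin φ ys K.≈ K.0#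
  lin-supported []             []       φ≈0 = K.refl
  lin-supported ((a , x) ∷ ys) (p ∷ ps) φ≈0 =
    K.trans (K.+-cong (K.trans (K.*-congˡ (φ≈0 x p)) (K.zeroʳ a)) (lin-supported ys ps φ≈0))
      (K.+-identityˡ K.0#)

  coefficient-homogeneous : ∀ {d} xs → Homogeneous d xs → ∀ z → ¬ degree z ≡ d →
                            coefficient z xs K.≈ K.0#
  coefficient-homogeneous xs (ys , ps , xs≈ys) z z≢d = K.trans (xs≈ys z)
    (lin-supported ys ps (λ x x≡d → δ-0 (λ z≈x → z≢d (trans (degree.⟦⟧-cong z≈x) x≡d))))

  component : ℕ → Carrier → Carrier
  component d = filter (λ (a , x) → degree x ℕ.≟ d)

  lin-component : ∀ φ {N} xs → All (λ (a , x) → degree x ℕ.< N) xs →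
                  lin φ xs K.≈ KSum.sum {N} (λ i → lin φ (component (toℕ i) xs))
  lin-component φ {N} []             []       = K.sym (KSum.sum-replicate-zero N)
  lin-component φ {N} ((a , x) ∷ xs) (p ∷ ps) = begin
    a K.* φ x K.+ lin φ xs
      ≈⟨ K.+-cong (K.sym sum-head≈) (lin-component φ xs ps) ⟩
    KSum.sum {N} head K.+ KSum.sum {N} (λ i → lin φ (component (toℕ i) xs))
      ≈⟨ KSum.∑-distrib-+ {N} head (λ i → lin φ (component (toℕ i) xs)) ⟨
    KSum.sum {N} (λ i → head i K.+ lin φ (component (toℕ i) xs))
      ≈⟨ KSum.sum-cong-≋ {N} (λ i → split (toℕ i)) ⟩
    KSum.sum {N} (λ i → lin φ (component (toℕ i) ((a , x) ∷ xs))) ∎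
    where
    open ≈-Reasoning

    headAt : ℕ → k
    headAt d = if does (degree x ℕ.≟ d) then a K.* φ x else K.0#

    head : Vector k N
    head i = headAt (toℕ i)

    headAt-≡ : ∀ {d} → degree x ≡ d → headAt d K.≈ a K.* φ x
    headAt-≡ {d} e rewrite dec-true (degree x ℕ.≟ d) e = K.refl

    headAt-≢ : ∀ {d} → ¬ degree x ≡ d → headAt d K.≈ K.0#
    headAt-≢ {d} ≢ rewrite dec-false (degree x ℕ.≟ d) ≢ = K.refl

    sum-head≈ : KSum.sum {N} head K.≈ a K.* φ x
    sum-head≈ = K.trans
      (sum-single head (Fin.fromℕ< p) (λ j j≢ → headAt-≢ (λ e →
        j≢ (Finₚ.toℕ-injective (trans (sym e) (sym (Finₚ.toℕ-fromℕ< p)))))))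
      (headAt-≡ (sym (Finₚ.toℕ-fromℕ< p)))

    split : ∀ d → headAt d K.+ lin φ (component d xs) K.≈ lin φ (component d ((a , x) ∷ xs))
    split d with does (degree x ℕ.≟ d)
    ... | true  = K.refl
    ... | false = K.+-identityˡ _

  bound : ∀ (xs : Carrier) → ∃[ N ] All (λ (a , x) → degree x ℕ.< N) xs
  bound []             = 0 , []
  bound ((a , x) ∷ xs) with bound xs
  ... | N , ps = suc (degree x) ℕ.⊔ N ,
    ℕₚ.m≤m⊔n (suc (degree x)) N ∷ All.map (λ p → ℕₚ.≤-trans p (ℕₚ.m≤n⊔m (suc (degree x)) N)) ps

  gradedAlgebra : GradedAlgebra K (c ⊔ m) (ℓ ⊔ m) (c ⊔ ℓ ⊔ m)
  gradedAlgebra = record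
    { commutativeRing = commutativeRing
    ; η = η
    ; η-isRingHomomorphism = record
      { isSemiringHomomorphism = record
        { isNearSemiringHomomorphism = record
          { +-isMonoidHomomorphism = record
            { isMagmaHomomorphism = record
              { isRelHomomorphism = record { cong = λ a≈b z → K.+-congʳ (K.*-congʳ a≈b) }
              ; homo = λ a b z → K.trans (K.+-identityʳ _)
                  (K.trans (K.distribʳ _ a b) (K.+-congˡ (K.sym (K.+-identityʳ _))))
              }
            ; ε-homo = λ z → K.trans (K.+-identityʳ _) (K.zeroˡ _)
            }
          ; *-homo = λ a b z → K.+-congʳ (K.*-congˡ (δ-cong z (M.sym (M.identityˡ M.ε))))
          }
        ; 1#-homo = λ z → K.refl
        }
      ; -‿homo = λ a z → K.refl
      }
    ; Homogeneous = Homogeneous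
    ; homogeneous-resp = λ xs≈ys (zs , ps , xs≈zs) →
        zs , ps , λ z → K.trans (K.sym (xs≈ys z)) (xs≈zs z)
    ; homogeneous-0# = [] , [] , λ z → K.refl
    ; homogeneous-+ = λ {d} {xs} {ys} (us , ps , xs≈us) (vs , qs , ys≈vs) →
        us + vs , Allₚ.++⁺ ps qs , A.+-cong {xs} {us} {ys} {vs} xs≈us ys≈vs
    ; homogeneous-* = λ {d} {e} {xs} {ys} (us , ps , xs≈us) (vs , qs , ys≈vs) →
        us * vs , all-* ps qs , *-cong {xs} {us} {ys} {vs} xs≈us ys≈vs
    ; homogeneous-η = λ a → η a , degree.ε-homo ∷ [] , λ z → K.refl
    ; decompose = λ xs → let (N , ps) = bound xs in
        N , (λ i → component (toℕ i) xs) ,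
        (λ i → component (toℕ i) xs , Allₚ.all-filter (λ (a , x) → degree x ℕ.≟ toℕ i) xs , λ z → K.refl) ,
        λ z → K.trans (lin-component (δ z) xs ps) (K.sym (lin-sum (δ z) {N} (λ i → component (toℕ i) xs)))
    ; independent = independent
    }
    where
    all-* : ∀ {d e us vs} → All (λ (a , x) → degree x ≡ d) us → All (λ (a , x) → degree x ≡ e) vs →
            All (λ (a , x) → degree x ≡ d ℕ.+ e) (us * vs)
    all-* []                         qs = []
    all-* (_∷_ {x = (a , x)} refl ps) qs =
      Allₚ.++⁺ (Allₚ.map⁺ (All.map (λ { {_ , y} refl → degree.homo x y }) qs)) (all-* ps qs)

    independent : ∀ {N} (ys : Vector Carrier N) → (∀ i → Homogeneous (toℕ i) (ys i)) →
                  sum ys ≈ 0# → ∀ i → ys i ≈ 0#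
    independent ys hs Σys≈0 i z with degree z ℕ.≟ toℕ i
    ... | no z≢i = coefficient-homogeneous (ys i) (hs i) z z≢i
    ... | yes z≡i = begin
      coefficient z (ys i)
        ≈⟨ sum-single (λ j → coefficient z (ys j)) i (λ j j≢i → coefficient-homogeneous (ys j) (hs j) z
             (λ z≡j → j≢i (Finₚ.toℕ-injective (trans (sym z≡j) z≡i)))) ⟨
      KSum.sum (λ j → coefficient z (ys j))  ≈⟨ lin-sum (δ z) ys ⟨
      coefficient z (sum ys)                 ≈⟨ Σys≈0 z ⟩
      K.0#                                   ∎
      where open ≈-Reasoning

-- lo ≤ x₀ ≤ x₁ ≤ ⋯ ≤ xₙ ≤ hi
Chain : {X : Set} (_≤_ : X → X → Set) (lo hi : X) {n : ℕ} → Vector X (suc n) → Set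
Chain _≤_ lo hi {n} x =
  lo ≤ x Fin.zero × (∀ i → x (Fin.inject₁ i) ≤ x (Fin.suc i)) × x (Fin.fromℕ n) ≤ hi

module LectureHall {n : ℕ} (b : Vector ℕ (suc n)) (b>0 : ∀ i → ℕ.NonZero (b i)) where

  open ≡ using (refl; sym; trans)
  open Real using (ℝ; 0ℝ; 1ℝ; ι)

  1/b : Fin (suc n) → ℚ
  1/b i = (+ 1 ℚ./ b i) {{b>0 i}}

  P : Vector ℝ (suc n) → Set
  P x = Chain Real._≤_ 0ℝ 1ℝ (λ i → ι (1/b i) Real.* x i)

  -- p ∈ kP ∩ ℤⁿ, that is, p = k x for a real point x of P.
  LatticePoint : ℕ → Vec ℤ (suc n) → Set
  LatticePoint k p = Σ[ x ∈ Vector ℝ (suc n) ] P x ×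
    (∀ i → ι (fromℤ (Vec.lookup p i)) Real.≈ ι (fromℤ (+ k)) Real.* x i)

  -- The inequalities 0 ≤ p₁/b₁ ≤ ⋯ ≤ pₙ/bₙ ≤ k, equivalent to p ∈ kP ∩ ℤⁿ.
  RationalChain : ℕ → Vec ℤ (suc n) → Set
  RationalChain k p = Chain ℚ._≤_ 0ℚ (fromℤ (+ k)) (λ i → 1/b i ℚ.* fromℤ (Vec.lookup p i))

  fromℤ-+ : ∀ i j → fromℤ (i ℤ.+ j) ≡ fromℤ i ℚ.+ fromℤ j
  fromℤ-+ i j = ℚₚ.toℚᵘ-injective (ℚᵘₚ.≃-trans (ℚᵘ.*≡* lem)
    (ℚᵘₚ.≃-sym (ℚₚ.toℚᵘ-homo-+ (fromℤ i) (fromℤ j))))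
    where
    lem : (i ℤ.+ j) ℤ.* + 1 ≡ (i ℤ.* + 1 ℤ.+ j ℤ.* + 1) ℤ.* + 1
    lem = cong (ℤ._* + 1) (sym (cong₂ ℤ._+_ (ℤₚ.*-identityʳ i) (ℤₚ.*-identityʳ j)))

  0≤fromℕ : ∀ k → 0ℚ ℚ.≤ fromℤ (+ k)
  0≤fromℕ k = ℚₚ.nonNegative⁻¹ (fromℤ (+ k))

  0<1/b : ∀ i → 0ℚ ℚ.< 1/b i
  0<1/b i = ℚₚ.positive⁻¹ (1/b i) {{ℚₚ.normalize-pos 1 (b i) {{b>0 i}}}}

  LatticePoint⇒RationalChain : ∀ {k p} → LatticePoint k p → RationalChain k p
  LatticePoint⇒RationalChain {k} {p} (x , (lower , steps , upper) , p≈kx) =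
    Real.ι-cancel-≤ (via {0ℝ} {y Fin.zero} {ι 0ℚ} {z Fin.zero}
      (Real.≈-pointwise {K Real.* 0ℝ} {0ℝ} (λ _ → ℚₚ.*-zeroʳ κ)) (Ky≈z Fin.zero) lower) ,
    (λ i → Real.ι-cancel-≤ (via {y (Fin.inject₁ i)} {y (Fin.suc i)}
      {z (Fin.inject₁ i)} {z (Fin.suc i)} (Ky≈z (Fin.inject₁ i)) (Ky≈z (Fin.suc i)) (steps i))) ,
    Real.ι-cancel-≤ (via {y (Fin.fromℕ n)} {1ℝ} {z (Fin.fromℕ n)} {K}
      (Ky≈z (Fin.fromℕ n)) (Real.≈-pointwise {K Real.* 1ℝ} {K} (λ _ → ℚₚ.*-identityʳ κ)) upper)
    where
    κ = fromℤ (+ k)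
    K = ι κ
    y z : Fin (suc n) → ℝ
    y i = ι (1/b i) Real.* x i
    z i = ι (1/b i ℚ.* fromℤ (Vec.lookup p i))

    swap : ∀ a c d → a ℚ.* (c ℚ.* d) ≡ c ℚ.* (a ℚ.* d)
    swap a c d = trans (sym (ℚₚ.*-assoc a c d))
      (trans (cong (ℚ._* d) (ℚₚ.*-comm a c)) (ℚₚ.*-assoc c a d))

    Ky≈z : ∀ i → K Real.* y i Real.≈ z i
    Ky≈z i = Real.≈-trans {K Real.* y i} {ι (1/b i) Real.* (K Real.* x i)} {z i}
      (Real.≈-pointwise {K Real.* y i} {ι (1/b i) Real.* (K Real.* x i)}
        (λ m → swap κ (1/b i) (Real.seq (x i) m)))
      (Real.*-cong {ι (1/b i)} {ι (1/b i)} {K Real.* x i} {ι (fromℤ (Vec.lookup p i))}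
        (Real.≈-refl {ι (1/b i)})
        (Real.≈-sym {ι (fromℤ (Vec.lookup p i))} {K Real.* x i} (p≈kx i)))

    via : ∀ {u v s t} → K Real.* u Real.≈ s → K Real.* v Real.≈ t → u Real.≤ v → s Real.≤ t
    via {u} {v} {s} {t} Ku≈s Kv≈t u≤v =
      Real.≤-trans {s} {K Real.* u} {t}
        (Real.≤-reflexive {s} {K Real.* u} (Real.≈-sym {K Real.* u} {s} Ku≈s))
        (Real.≤-trans {K Real.* u} {K Real.* v} {t}
          (Real.*-monoˡ-≤ {κ} {u} {v} (0≤fromℕ k) u≤v)
          (Real.≤-reflexive {K Real.* v} {t} Kv≈t))

  chain-lower : ∀ {lo hi m} (f : Vector ℚ (suc m)) → Chain ℚ._≤_ lo hi f → ∀ i → lo ℚ.≤ f i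
  chain-lower f (l , s , u) Fin.zero = l
  chain-lower {m = suc m} f (l , s , u) (Fin.suc i) =
    chain-lower (f ∘ Fin.suc) (ℚₚ.≤-trans l (s Fin.zero) , s ∘ Fin.suc , u) i

  chain-upper : ∀ {lo hi m} (f : Vector ℚ (suc m)) → Chain ℚ._≤_ lo hi f → ∀ i → f i ℚ.≤ hi
  chain-upper {m = zero}  f (l , s , u) Fin.zero = u
  chain-upper {m = suc m} f (l , s , u) Fin.zero = ℚₚ.≤-trans (s Fin.zero)
    (chain-upper (f ∘ Fin.suc) (ℚₚ.≤-trans l (s Fin.zero) , s ∘ Fin.suc , u) Fin.zero)
  chain-upper {m = suc m} f (l , s , u) (Fin.suc i) =
    chain-upper (f ∘ Fin.suc) (ℚₚ.≤-trans l (s Fin.zero) , s ∘ Fin.suc , u) i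

  scaled : ∀ {k p} r → 0ℚ ℚ.≤ r → r ℚ.* fromℤ (+ k) ℚ.≤ 1ℚ → RationalChain k p →
           P (λ i → ι (r ℚ.* fromℤ (Vec.lookup p i)))
  scaled {k} {p} r 0≤r rk≤1 (l , s , u) =
    ι-mono (ℚₚ.≤-trans (ℚₚ.≤-reflexive (sym (ℚₚ.*-zeroʳ r))) (mono l))
           refl (swap Fin.zero) ,
    (λ i → ι-mono (mono (s i)) (swap (Fin.inject₁ i)) (swap (Fin.suc i))) ,
    ι-mono (ℚₚ.≤-trans (mono u) rk≤1) (swap (Fin.fromℕ n)) refl
    where
    q : Fin (suc n) → ℚ
    q i = fromℤ (Vec.lookup p i)

    mono : ∀ {c d} → c ℚ.≤ d → r ℚ.* c ℚ.≤ r ℚ.* d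
    mono = ℚₚ.*-monoˡ-≤-nonNeg r {{ℚ.nonNegative 0≤r}}

    ι-mono : ∀ {c d c′ d′} → c ℚ.≤ d → c ≡ c′ → d ≡ d′ →
             ∀ ε → 0ℚ ℚ.< ε → ∃[ N ] ∀ (m : ℕ) → N ℕ.≤ m → c′ ℚ.- d′ ℚ.< ε
    ι-mono c≤d refl refl = Real.ι-mono-≤ c≤d

    swap : ∀ i → r ℚ.* (1/b i ℚ.* q i) ≡ 1/b i ℚ.* (r ℚ.* q i)
    swap i = trans (sym (ℚₚ.*-assoc r (1/b i) (q i)))
      (trans (cong (ℚ._* q i) (ℚₚ.*-comm r (1/b i))) (ℚₚ.*-assoc (1/b i) r (q i)))

  RationalChain⇒LatticePoint : ∀ {k p} → RationalChain k p → LatticePoint k p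
  RationalChain⇒LatticePoint {zero} {p} chain =
    (λ i → ι (0ℚ ℚ.* fromℤ (Vec.lookup p i))) ,
    scaled {0} {p} 0ℚ ℚₚ.≤-refl (ℚₚ.<⇒≤ Real.0<1) chain ,
    λ i → Real.≈-pointwise {ι (fromℤ (Vec.lookup p i))} {ι (fromℤ (+ 0) ℚ.* (0ℚ ℚ.* fromℤ (Vec.lookup p i)))}
      (λ _ → trans (p≡0 i) (sym (ℚₚ.*-zeroˡ (0ℚ ℚ.* fromℤ (Vec.lookup p i)))))
    where
    p≡0 : ∀ i → fromℤ (Vec.lookup p i) ≡ 0ℚ
    p≡0 i = ℚₚ.≤-antisym
      (ℚₚ.*-cancelˡ-≤-pos (1/b i) {{ℚ.positive (0<1/b i)}}
        (ℚₚ.≤-trans (chain-upper _ chain i) (ℚₚ.≤-reflexive (sym (ℚₚ.*-zeroʳ (1/b i))))))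
      (ℚₚ.*-cancelˡ-≤-pos (1/b i) {{ℚ.positive (0<1/b i)}}
        (ℚₚ.≤-trans (ℚₚ.≤-reflexive (ℚₚ.*-zeroʳ (1/b i))) (chain-lower _ chain i)))
  RationalChain⇒LatticePoint {suc k} {p} chain =
    let κ = fromℤ (+ suc k)
        (r , 0<r , κr≡1) = Real.divide (ℚₚ.positive⁻¹ κ) Real.0<1
        q = λ i → fromℤ (Vec.lookup p i)
    in (λ i → ι (r ℚ.* q i)) ,
       scaled {suc k} {p} r (ℚₚ.<⇒≤ 0<r)
         (ℚₚ.≤-reflexive (trans (ℚₚ.*-comm r κ) κr≡1)) chain ,
       λ i → Real.≈-pointwise {ι (q i)} {ι (κ ℚ.* (r ℚ.* q i))}
         (λ _ → sym (trans (sym (ℚₚ.*-assoc κ r (q i)))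
           (trans (cong (ℚ._* q i) κr≡1) (ℚₚ.*-identityˡ (q i)))))

  _+ᵛ_ : Vec ℤ (suc n) → Vec ℤ (suc n) → Vec ℤ (suc n)
  _+ᵛ_ = Vec.zipWith ℤ._+_

  0ᵛ : Vec ℤ (suc n)
  0ᵛ = Vec.replicate (suc n) (+ 0)

  lattice-+ : ∀ {j k p q} → LatticePoint j p → LatticePoint k q → LatticePoint (j ℕ.+ k) (p +ᵛ q)
  lattice-+ {j} {k} {p} {q} P Q = RationalChain⇒LatticePoint {j ℕ.+ k} {p +ᵛ q}
    (subst (0ℚ ℚ.≤_) (term Fin.zero) (ℚₚ.≤-trans (ℚₚ.≤-reflexive (sym (ℚₚ.+-identityˡ 0ℚ))) (ℚₚ.+-mono-≤ l l′)) ,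
     (λ i → subst₂ ℚ._≤_ (term (Fin.inject₁ i)) (term (Fin.suc i)) (ℚₚ.+-mono-≤ (s i) (s′ i))) ,
     subst₂ ℚ._≤_ (term (Fin.fromℕ n)) (sym (fromℤ-+ (+ j) (+ k))) (ℚₚ.+-mono-≤ u u′))
    where
    chain  = LatticePoint⇒RationalChain {j} {p} P
    chain′ = LatticePoint⇒RationalChain {k} {q} Q
    l = proj₁ chain; s = proj₁ (proj₂ chain); u = proj₂ (proj₂ chain)
    l′ = proj₁ chain′; s′ = proj₁ (proj₂ chain′); u′ = proj₂ (proj₂ chain′)
    term : ∀ i → 1/b i ℚ.* fromℤ (Vec.lookup p i) ℚ.+ 1/b i ℚ.* fromℤ (Vec.lookup q i) ≡
                 1/b i ℚ.* fromℤ (Vec.lookup (p +ᵛ q) i)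
    term i = trans (sym (ℚₚ.*-distribˡ-+ (1/b i) _ _)) (cong (1/b i ℚ.*_)
      (trans (sym (fromℤ-+ (Vec.lookup p i) (Vec.lookup q i)))
             (cong fromℤ (sym (Vecₚ.lookup-zipWith ℤ._+_ i p q)))))

  lattice-0 : LatticePoint 0 0ᵛ
  lattice-0 = RationalChain⇒LatticePoint {0} {0ᵛ}
    (ℚₚ.≤-reflexive (sym (term Fin.zero)) ,
     (λ i → ℚₚ.≤-reflexive (trans (term (Fin.inject₁ i)) (sym (term (Fin.suc i))))) ,
     ℚₚ.≤-reflexive (term (Fin.fromℕ n)))
    where
    term : ∀ i → 1/b i ℚ.* fromℤ (Vec.lookup 0ᵛ i) ≡ 0ℚ
    term i = trans (cong (λ z → 1/b i ℚ.* fromℤ z) (Vecₚ.lookup-replicate i (+ 0))) (ℚₚ.*-zeroʳ (1/b i))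

  -- The exponents (p , k) of the monomials t^(p,k); only p and k matter for equality.
  exponents : CommutativeMonoid 0ℓ 0ℓ
  exponents = record
    { Carrier = Σ[ (p , k) ∈ Vec ℤ (suc n) × ℕ ] LatticePoint k p
    ; _≈_ = λ x y → proj₁ x ≡ proj₁ y
    ; _∙_ = λ { ((p , j) , P) ((q , k) , Q) →
        (p +ᵛ q , j ℕ.+ k) , lattice-+ {j} {k} {p} {q} P Q }
    ; ε = (0ᵛ , 0) , lattice-0
    ; isCommutativeMonoid = record
      { isMonoid = record
        { isSemigroup = record
          { isMagma = record
            { isEquivalence = record { refl = refl ; sym = sym ; trans = trans }
            ; ∙-cong = λ e f → cong₂ (λ (p , j) (q , k) → p +ᵛ q , j ℕ.+ k) e f
            }
          ; assoc = λ { ((p , j) , _) ((q , k) , _) ((r , l) , _) →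
              cong₂ _,_ (Vecₚ.zipWith-assoc ℤₚ.+-assoc p q r) (ℕₚ.+-assoc j k l) }
          }
        ; identity =
            (λ { ((p , j) , _) →
              cong (_, j) (Vecₚ.zipWith-identityˡ ℤₚ.+-identityˡ p) }) ,
            (λ { ((p , j) , _) →
              cong₂ _,_ (Vecₚ.zipWith-identityʳ ℤₚ.+-identityʳ p) (ℕₚ.+-identityʳ j) })
        }
      ; comm = λ { ((p , j) , _) ((q , k) , _) →
          cong₂ _,_ (Vecₚ.zipWith-comm ℤₚ.+-comm p q) (ℕₚ.+-comm j k) }
      }
    }

  _≟_ : Decidable (CommutativeMonoid._≈_ exponents)
  x ≟ y = Productₚ.≡-dec (Vecₚ.≡-dec ℤ._≟_) ℕ._≟_ (proj₁ x) (proj₁ y)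

  height : CommutativeMonoid.Carrier exponents → ℕ
  height ((p , k) , _) = k

  height-isMonoidHomomorphism :
    IsMonoidHomomorphism (CommutativeMonoid.rawMonoid exponents) ℕ.+-0-rawMonoid height
  height-isMonoidHomomorphism = record
    { isMagmaHomomorphism = record
      { isRelHomomorphism = record { cong = cong proj₂ }
      ; homo = λ _ _ → refl
      }
    ; ε-homo = refl
    }

  ehrhartRing : GradedAlgebra Complex.commutativeRing 0ℓ 0ℓ 0ℓ
  ehrhartRing = MonoidAlgebra.gradedAlgebra
    Complex.commutativeRing exponents _≟_ height height-isMonoidHomomorphism

open LectureHall public using (ehrhartRing)

{-# OPTIONS --safe #-}
-- The exponents form a submonoid M of ℕ^{n+1} (with the degree k as a further coordinate, where b is 1)
-- which is closed under the truncations z ↦ min(b, z) and z ↦ z - min(b, z), because these preserve the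
-- inequalities z_i b_{i+1} ≤ z_{i+1} b_i. Hence every monomial of positive degree is divisible by the
-- degree 1 monomial min(b, z), which moreover has the same support and is the largest degree 1 divisor.
-- For a set S of coordinates let I_S be the ideal of all z with z_i > 0 for some i ∈ S; it is generated by
-- its degree 1 elements. If these are added one by one, larger ones first, then the colon ideal at x consists
-- of the z with min(b, z + x) ≠ x, which is I_S′ for S′ = {i : x_i < b_i}. So the ideals I_S form a Koszul
-- filtration containing the maximal ideal. Whenever the successive colon ideals of a list of generators lie
-- in such a family, the same holds for the syzygies obtained by lifting the generators of the colon ideals;
-- iterating this resolves the residue field linearly.
module Submission where

import Algebra.Properties.AbelianGroup as AbelianGroupProperties
import Algebra.Properties.CommutativeSemigroup as CommutativeSemigroupProperties
import Algebra.Properties.Group as GroupProperties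
import Algebra.Properties.Ring as RingProperties
import Data.Fin.Properties as Finₚ
import Data.Integer.Properties as ℤₚ
import Data.List.Relation.Unary.All.Properties as Allₚ
import Data.List.Relation.Unary.AllPairs.Properties as AllPairsₚ
import Data.List.Relation.Unary.Any.Properties as Anyₚ
import Data.Nat.Properties as ℕₚ
import Data.Rational.Properties as ℚₚ
import Data.Rational.Unnormalised.Base as ℚᵘ
import Data.Rational.Unnormalised.Properties as ℚᵘₚ
import Data.Vec.Base as Vec
import Data.Vec.Functional as V
import Data.Vec.Properties as Vecₚ
import Relation.Binary.Reasoning.Setoid as SetoidReasoning
open import Algebra.Bundles using (CommutativeRing; CommutativeMonoid)
open import Algebra.Module.Bundles using (LeftModule)
open import Algebra.Module.Construct.TensorUnit using (leftModule)
open import Algebra.Module.Morphism.Structures using (module LeftModuleMorphisms)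
open import Algebra.Morphism.Structures using (module MonoidMorphisms)
open import Data.Bool.Base as Bool using (Bool; if_then_else_; true; false)
open import Data.Fin.Base as Fin using (Fin; zero; suc)
open import Data.Integer.Base as ℤ using (ℤ; +_; ∣_∣)
open import Data.List.Base using (List; []; _∷_; _++_; map; length; filter; lookup; concat; upTo)
open import Data.List.Membership.Propositional.Properties using (∈-lookup; ∈-upTo⁺)
open import Data.List.Properties using (filter-++; filter-all; filter-none; filter-accept; filter-reject)
open import Data.List.Relation.Unary.All as All using (All; []; _∷_)
open import Data.List.Relation.Unary.AllPairs as AllPairs using (AllPairs; []; _∷_)
open import Data.List.Relation.Unary.Any as Any using (Any; here; there)
open import Data.Nat as ℕ using (ℕ; zero; suc; NonZero; _⊓_; _∸_)
open import Data.Product.Base using (_×_; _,_; proj₁; proj₂; ∃-syntax)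
open import Data.Rational.Base as ℚ using (0ℚ)
open import Data.Rational.Literals using (fromℤ)
open import Data.Sum.Base using (inj₁; inj₂)
open import Data.Unit.Base using (⊤; tt)
open import Data.Vec.Functional using (Vector)
open import Function.Base using (_∘_; id)
open import Function.Bundles using (mk⇔)
open import Level using (Level; _⊔_; 0ℓ; lift; lower)
open import Relation.Binary.Definitions using (Decidable)
open import Relation.Binary.PropositionalEquality as ≡ using (_≡_; _≗_)
open import Relation.Nullary using (¬_; Dec; yes; no; does; contradiction)
open import Relation.Nullary.Decidable using (⌊_⌋; map′; _×-dec_; T?; toWitness; fromWitness)
open import Defs

open LeftModuleMorphisms using (IsLeftModuleHomomorphism)
open MonoidMorphisms using (IsMonoidHomomorphism)

-- Koszul filtrations

module KoszulFiltrations {c ℓ a ℓa h : Level} {K : CommutativeRing c ℓ}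
                         (A : GradedAlgebra K a ℓa h) where

  open GradedAlgebra A hiding (zero)
  open RingProperties ring using (-0#≈0#)

  -- Linear combinations of lists of module elements

  module Combinations {m ℓm : Level} (N : LeftModule ring m ℓm) where

    open LeftModule N

    -- An inductive family along the list: one induction serves both `Span` and `LinearSpan`, and
    -- the coefficients can be read off as a vector, later a column of a differential.
    data Combination {p : Level} (P : Carrier → Set p) :
                     List Carrierᴹ → Carrierᴹ → Set (a ⊔ p ⊔ m ⊔ ℓm) where
      nil  : ∀ {v} → v ≈ᴹ 0ᴹ → Combination P [] v
      cons : ∀ {g gs v w} r → P r → Combination P gs w → v ≈ᴹ r *ₗ g +ᴹ w →
             Combination P (g ∷ gs) v

    Span : List Carrierᴹ → Carrierᴹ → Set (a ⊔ m ⊔ ℓm)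
    Span = Combination (λ _ → ⊤)

    LinearSpan : List Carrierᴹ → Carrierᴹ → Set (a ⊔ h ⊔ m ⊔ ℓm)
    LinearSpan = Combination (Homogeneous 1)

    module _ {p : Level} {P : Carrier → Set p} where

      resp-≈ᴹ : ∀ {gs v w} → v ≈ᴹ w → Combination P gs v → Combination P gs w
      resp-≈ᴹ v≈w (nil v≈0)        = nil (≈ᴹ-trans (≈ᴹ-sym v≈w) v≈0)
      resp-≈ᴹ v≈w (cons r pr p v≈) = cons r pr p (≈ᴹ-trans (≈ᴹ-sym v≈w) v≈)

      forget : ∀ {gs v} → Combination P gs v → Span gs v
      forget (nil v≈0)       = nil v≈0
      forget (cons r _ p v≈) = cons r tt (forget p) v≈

      coefficients : ∀ {gs v} → Combination P gs v → Vector Carrier (length gs)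
      coefficients (cons r _ p _) zero    = r
      coefficients (cons r _ p _) (suc i) = coefficients p i

      coefficients-P : ∀ {gs v} (p : Combination P gs v) i → P (coefficients p i)
      coefficients-P (cons r pr p _) zero    = pr
      coefficients-P (cons r pr p _) (suc i) = coefficients-P p i

    combine : (gs : List Carrierᴹ) → Vector Carrier (length gs) → Carrierᴹ
    combine []       v = 0ᴹ
    combine (g ∷ gs) v = v zero *ₗ g +ᴹ combine gs (v ∘ suc)

    combine-coefficients : ∀ {p} {P : Carrier → Set p} {gs v} (q : Combination P gs v) →
                           combine gs (coefficients q) ≈ᴹ v
    combine-coefficients (nil v≈0)       = ≈ᴹ-sym v≈0
    combine-coefficients (cons r _ p v≈) =
      ≈ᴹ-trans (+ᴹ-cong ≈ᴹ-refl (combine-coefficients p)) (≈ᴹ-sym v≈)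

    span-combine : ∀ gs v → Span gs (combine gs v)
    span-combine []       v = nil ≈ᴹ-refl
    span-combine (g ∷ gs) v = cons (v zero) tt (span-combine gs (v ∘ suc)) ≈ᴹ-refl

    combine-cong : ∀ gs {v w} → (∀ i → v i ≈ w i) → combine gs v ≈ᴹ combine gs w
    combine-cong []       v≈w = ≈ᴹ-refl
    combine-cong (g ∷ gs) v≈w = +ᴹ-cong (*ₗ-cong (v≈w zero) ≈ᴹ-refl) (combine-cong gs (v≈w ∘ suc))

    +ᴹ-interchange : ∀ u v w x → (u +ᴹ v) +ᴹ (w +ᴹ x) ≈ᴹ (u +ᴹ w) +ᴹ (v +ᴹ x)
    +ᴹ-interchange = interchange
      where open CommutativeSemigroupProperties (CommutativeMonoid.commutativeSemigroup +ᴹ-commutativeMonoid) using (interchange)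

    combination-0 : ∀ {p} {P : Carrier → Set p} → P 0# → ∀ gs → Combination P gs 0ᴹ
    combination-0 p0 []       = nil ≈ᴹ-refl
    combination-0 p0 (g ∷ gs) = cons 0# p0 (combination-0 p0 gs)
      (≈ᴹ-sym (≈ᴹ-trans (+ᴹ-cong (*ₗ-zeroˡ g) ≈ᴹ-refl) (+ᴹ-identityˡ 0ᴹ)))

    span-+ : ∀ {gs v w} → Span gs v → Span gs w → Span gs (v +ᴹ w)
    span-+ (nil v≈0)       (nil w≈0)       = nil (≈ᴹ-trans (+ᴹ-cong v≈0 w≈0) (+ᴹ-identityˡ 0ᴹ))
    span-+ (cons r _ p v≈) (cons s _ q w≈) = cons (r + s) tt (span-+ p q)
      (≈ᴹ-trans (+ᴹ-cong v≈ w≈) (≈ᴹ-trans (+ᴹ-interchange _ _ _ _)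
        (+ᴹ-cong (≈ᴹ-sym (*ₗ-distribʳ _ r s)) ≈ᴹ-refl)))

    combine-+ : ∀ gs v w → combine gs (λ i → v i + w i) ≈ᴹ combine gs v +ᴹ combine gs w
    combine-+ []       v w = ≈ᴹ-sym (+ᴹ-identityˡ 0ᴹ)
    combine-+ (g ∷ gs) v w = ≈ᴹ-trans
      (+ᴹ-cong (*ₗ-distribʳ g (v zero) (w zero)) (combine-+ gs (v ∘ suc) (w ∘ suc)))
      (+ᴹ-interchange _ _ _ _)

    combine-* : ∀ r gs v → combine gs (λ i → r * v i) ≈ᴹ r *ₗ combine gs v
    combine-* r []       v = ≈ᴹ-sym (*ₗ-zeroʳ r)
    combine-* r (g ∷ gs) v = ≈ᴹ-trans
      (+ᴹ-cong (*ₗ-assoc r (v zero) g) (combine-* r gs (v ∘ suc)))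
      (≈ᴹ-sym (*ₗ-distribˡ r _ _))

    combine-0 : ∀ gs → combine gs (λ _ → 0#) ≈ᴹ 0ᴹ
    combine-0 []       = ≈ᴹ-refl
    combine-0 (g ∷ gs) = ≈ᴹ-trans (+ᴹ-cong (*ₗ-zeroˡ g) (combine-0 gs)) (+ᴹ-identityˡ 0ᴹ)

    combine-neg : ∀ gs v → combine gs (λ i → - v i) ≈ᴹ -ᴹ combine gs v
    combine-neg gs v = inverseˡ-unique _ _ (≈ᴹ-trans (≈ᴹ-sym (combine-+ gs (-_ ∘ v) v))
      (≈ᴹ-trans (combine-cong gs (λ i → -‿inverseˡ (v i))) (combine-0 gs)))
      where open GroupProperties +ᴹ-group using (inverseˡ-unique)

  open Combinations

  -- Linear quotients and their transport along linear maps

  regular : LeftModule ring a ℓa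
  regular = leftModule

  -- Generators are added from the end of the list: for g ∷ gs, the colon ideal (span gs : g) is the member φ of the family.
  data LinearQuotients {m ℓm i : Level} (N : LeftModule ring m ℓm) {Index : Set i} (gens : Index → List Carrier) :
                       List (LeftModule.Carrierᴹ N) → Set (i ⊔ a ⊔ ℓa ⊔ h ⊔ m ⊔ ℓm) where
    []       : LinearQuotients N gens []
    quotient : ∀ {g gs} φ →
               (∀ r → Span N gs (LeftModule._*ₗ_ N r g) → Span regular (gens φ) r) →
               All (λ x → LinearSpan N gs (LeftModule._*ₗ_ N x g)) (gens φ) →
               LinearQuotients N gens gs → LinearQuotients N gens (g ∷ gs)

  record IsLinear {m ℓm m′ ℓm′ : Level} (N : LeftModule ring m ℓm) (N′ : LeftModule ring m′ ℓm′)
                  (f : LeftModule.Carrierᴹ N → LeftModule.Carrierᴹ N′) : Set (a ⊔ m ⊔ ℓm ⊔ ℓm′) where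
    private
      module N = LeftModule N
      module N′ = LeftModule N′
    field
      f-cong : ∀ {v w} → v N.≈ᴹ w → f v N′.≈ᴹ f w
      f-0    : f N.0ᴹ N′.≈ᴹ N′.0ᴹ
      f-+    : ∀ v w → f (v N.+ᴹ w) N′.≈ᴹ f v N′.+ᴹ f w
      f-*    : ∀ r v → f (r N.*ₗ v) N′.≈ᴹ r N′.*ₗ f v

  module _ {m ℓm m′ ℓm′ : Level} {N : LeftModule ring m ℓm} {N′ : LeftModule ring m′ ℓm′}
           {f : LeftModule.Carrierᴹ N → LeftModule.Carrierᴹ N′} (f-linear : IsLinear N N′ f) where
    private
      module N = LeftModule N
      module N′ = LeftModule N′
    open IsLinear f-linear

    combination-map : ∀ {p} {P : Carrier → Set p} {gs v} →
                      Combination N P gs v → Combination N′ P (map f gs) (f v)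
    combination-map (nil v≈0)        = nil (N′.≈ᴹ-trans (f-cong v≈0) f-0)
    combination-map (cons r pr p v≈) = cons r pr (combination-map p)
      (N′.≈ᴹ-trans (f-cong v≈) (N′.≈ᴹ-trans (f-+ _ _) (N′.+ᴹ-cong (f-* _ _) N′.≈ᴹ-refl)))

    module _ {ρ : LeftModule.Carrierᴹ N′ → LeftModule.Carrierᴹ N} (ρ-linear : IsLinear N′ N ρ)
             (ρ∘f : ∀ v → ρ (f v) N.≈ᴹ v) where
      private module ρ = IsLinear ρ-linear

      combination-unmap : ∀ {p} {P : Carrier → Set p} gs {v} →
                          Combination N′ P (map f gs) v → Combination N P gs (ρ v)
      combination-unmap []       (nil v≈0)        = nil (N.≈ᴹ-trans (ρ.f-cong v≈0) ρ.f-0)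
      combination-unmap (g ∷ gs) (cons r pr p v≈) = cons r pr (combination-unmap gs p)
        (N.≈ᴹ-trans (ρ.f-cong v≈) (N.≈ᴹ-trans (ρ.f-+ _ _)
          (N.+ᴹ-cong (N.≈ᴹ-trans (ρ.f-* _ _) (N.*ₗ-cong refl (ρ∘f g))) N.≈ᴹ-refl)))

      -- A relation among the images is pulled back by the linear retraction `ρ`, so the colon
      -- ideals do not change along `f`. The cases used are prepending a zero coordinate and
      -- identifying `A` with `free A 1`.
      linearQuotients-map : ∀ {i} {Index : Set i} {gens : Index → List Carrier} {gs} →
                            LinearQuotients N gens gs → LinearQuotients N′ gens (map f gs)
      linearQuotients-map []                    = []
      linearQuotients-map (quotient {g} {gs} φ kills relations q) = quotient φ
        (λ r p → kills r (resp-≈ᴹ N (N.≈ᴹ-trans (ρ.f-* r _) (N.*ₗ-cong refl (ρ∘f g)))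
          (combination-unmap gs p)))
        (All.map (λ p → resp-≈ᴹ N′ (f-* _ _) (combination-map p)) relations)
        (linearQuotients-map q)

  0∷-linear : ∀ n → IsLinear (free A n) (free A (suc n)) (0# V.∷_)
  0∷-linear n = record
    { f-cong = λ { v≈w zero → refl ; v≈w (suc i) → v≈w i }
    ; f-0    = λ { zero → refl ; (suc i) → refl }
    ; f-+    = λ { v w zero → sym (+-identityˡ 0#) ; v w (suc i) → refl }
    ; f-*    = λ { r v zero → sym (zeroʳ r) ; r v (suc i) → refl }
    }

  tail-linear : ∀ n → IsLinear (free A (suc n)) (free A n) (_∘ suc)
  tail-linear n = record
    { f-cong = λ v≈w i → v≈w (suc i)
    ; f-0    = λ i → refl
    ; f-+    = λ v w i → refl
    ; f-*    = λ r v i → refl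
    }

  const-linear : IsLinear regular (free A 1) (λ x _ → x)
  const-linear = record
    { f-cong = λ v≈w i → v≈w
    ; f-0    = λ i → refl
    ; f-+    = λ v w i → refl
    ; f-*    = λ r v i → refl
    }

  head-linear : IsLinear (free A 1) regular (λ v → v zero)
  head-linear = record
    { f-cong = λ v≈w → v≈w zero
    ; f-0    = refl
    ; f-+    = λ v w → refl
    ; f-*    = λ r v → refl
    }

  x+[y-x]≈y : ∀ x y → x + (y - x) ≈ y
  x+[y-x]≈y x y = trans (sym (+-assoc x y (- x))) (xyx⁻¹≈y x y)
    where open AbelianGroupProperties +-abelianGroup using (xyx⁻¹≈y)

  -- Degrees in graded free modules

  homogeneousℤ-0 : ∀ d → Homogeneousℤ d 0#
  homogeneousℤ-0 (+ _)        = lift homogeneous-0#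
  homogeneousℤ-0 ℤ.-[1+ _ ]   = lift refl

  homogeneousℤ-≈ : ∀ d {x y} → x ≈ y → Homogeneousℤ d x → Homogeneousℤ d y
  homogeneousℤ-≈ (+ _)      x≈y (lift x) = lift (homogeneous-resp x≈y x)
  homogeneousℤ-≈ ℤ.-[1+ _ ] x≈y (lift x) = lift (trans (sym x≈y) x)

  homogeneousℤ-+ : ∀ d {x y} → Homogeneousℤ d x → Homogeneousℤ d y → Homogeneousℤ d (x + y)
  homogeneousℤ-+ (+ _)      (lift x) (lift y) = lift (homogeneous-+ x y)
  homogeneousℤ-+ ℤ.-[1+ _ ] (lift x) (lift y) = lift (trans (+-cong x y) (+-identityˡ 0#))

  homogeneousℤ-* : ∀ d {x y} → Homogeneousℤ d x → Homogeneous 1 y → Homogeneousℤ (ℤ.suc d) (x * y)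
  homogeneousℤ-* (+ k)      {x} {y} (lift xₖ) y₁ = lift (homogeneous-resp (*-comm y x) (homogeneous-* y₁ xₖ))
  homogeneousℤ-* ℤ.-[1+ k ] {x} {y} (lift x≈0) y₁ =
    -- Zero is homogeneous of every degree, which covers the case where raising the degree from -1
    -- reaches 0.
    homogeneousℤ-≈ _ (sym (trans (*-congʳ x≈0) (zeroˡ y))) (homogeneousℤ-0 (ℤ.suc ℤ.-[1+ k ]))

  combine-graded : ∀ {n} d gs v → All (λ g → ∀ j → Homogeneous 1 (g j)) gs →
                   (∀ j → Homogeneousℤ d (v j)) → ∀ (j : Fin n) → Homogeneousℤ (ℤ.suc d) (combine (free A n) gs v j)
  combine-graded d []       v []         hv j = homogeneousℤ-0 (ℤ.suc d)
  combine-graded d (g ∷ gs) v (g₁ ∷ gs₁) hv j = homogeneousℤ-+ (ℤ.suc d)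
    (homogeneousℤ-* d (hv zero) (g₁ j)) (combine-graded d gs (v ∘ suc) gs₁ (hv ∘ suc) j)

  combine-isLeftModuleHomomorphism : ∀ n gs → IsLeftModuleHomomorphism
    (LeftModule.rawLeftModule (free A (length gs))) (LeftModule.rawLeftModule (free A n)) (combine (free A n) gs)
  combine-isLeftModuleHomomorphism n gs = record
    { +ᴹ-isGroupHomomorphism = record
      { isMonoidHomomorphism = record
        { isMagmaHomomorphism = record
          { isRelHomomorphism = record { cong = combine-cong (free A n) gs }
          ; homo = combine-+ (free A n) gs
          }
        ; ε-homo = combine-0 (free A n) gs
        }
      ; ⁻¹-homo = combine-neg (free A n) gs
      }
    ; *ₗ-homo = λ r → combine-* (free A n) r gs
    }

  span⇒A>0 : ∀ {xs x} → All (Homogeneous 1) xs → Span regular xs x → A>0 A x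
  span⇒A>0 []       (nil x≈0)        = resp (sym x≈0) null
  span⇒A>0 (x₁ ∷ xs₁) (cons r _ p x≈) =
    resp (sym x≈) (plus (A>0-* A r (homogeneous x₁)) (span⇒A>0 xs₁ p))

  -- `decompose` only asserts that homogeneous parts exist. `linearize` needs them as functions that
  -- respect equality, sums and multiplication by a homogeneous element.
  record Components : Set (a ⊔ ℓa ⊔ h) where
    field
      π             : ℕ → Carrier → Carrier
      π-cong        : ∀ d {x y} → x ≈ y → π d x ≈ π d y
      π-+           : ∀ d x y → π d (x + y) ≈ π d x + π d y
      π-homogeneous : ∀ d x → Homogeneous d (π d x)
      π-identity    : ∀ {d x} → Homogeneous d x → π d x ≈ x
      π-*           : ∀ d {e} x {y} → Homogeneous e y → π (d ℕ.+ e) (x * y) ≈ π d x * y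

  -- Syzygies of generators with linear quotients

  module Resolution {i : Level} {Index : Set i} (components : Components)
    (gens : Index → List Carrier) (gens-A₁ : ∀ φ → All (Homogeneous 1) (gens φ))
    (gens-quotients : ∀ φ → LinearQuotients regular gens (gens φ))
    where

    open Components components

    -- If v = Σ r g and all entries of the g have degree 1, the degree 2 parts satisfy π₂ v = Σ
    -- π₁(r) g. So an element of degree 2 in the span has coefficients that can be chosen of degree
    -- 1.
    linearize : ∀ {n gs v} → All (λ g → ∀ j → Homogeneous 1 (g j)) gs →
                Span (free A n) gs v → LinearSpan (free A n) gs (π 2 ∘ v)
    linearize [] (nil v≈0) = nil λ j → trans (π-cong 2 (v≈0 j)) (π-identity homogeneous-0#)
    linearize (g₁ ∷ gs₁) (cons r _ p v≈) = cons (π 1 r) (π-homogeneous 1 r) (linearize gs₁ p)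
      λ j → trans (π-cong 2 (v≈ j)) (trans (π-+ 2 _ _) (+-congʳ (π-* 1 r (g₁ j))))

    module _ {m ℓm : Level} {N : LeftModule ring m ℓm} where

      private module N = LeftModule N

      Syzygy : (gs : List N.Carrierᴹ) → Vector Carrier (length gs) → Set ℓm
      Syzygy gs v = combine N gs v N.≈ᴹ N.0ᴹ

      -- An equation x g = Σ c h over the members h of `gs` is the syzygy (x, -c) of `g ∷ gs`.
      lifts : ∀ {g gs xs} → All (λ x → LinearSpan N gs (x N.*ₗ g)) xs →
              List (Vector Carrier (suc (length gs)))
      lifts []                = []
      lifts (_∷_ {x = x} p ps) = (x V.∷ -_ ∘ coefficients N p) ∷ lifts ps

      -- The head of a syzygy of `g ∷ gs` lies in the colon ideal, and a syzygy with head 0 comes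
      -- from one of `gs`. Hence lifts of the colon generators together with the padded syzygies of
      -- `gs` suffice.
      syzygies : ∀ {gs} → LinearQuotients N gens gs → List (Vector Carrier (length gs))
      syzygies []                         = []
      syzygies (quotient φ _ relations q) = lifts relations ++ map (0# V.∷_) (syzygies q)

      syzygy-lift : ∀ {g gs x} (p : LinearSpan N gs (x N.*ₗ g)) →
                    Syzygy (g ∷ gs) (x V.∷ -_ ∘ coefficients N p)
      syzygy-lift {g} {gs} p = N.≈ᴹ-trans
        (N.+ᴹ-cong N.≈ᴹ-refl (N.≈ᴹ-trans (combine-neg N gs (coefficients N p))
          (N.-ᴹ‿cong (combine-coefficients N p))))
        (N.-ᴹ‿inverseʳ _)

      syzygy-* : ∀ {gs v} r → Syzygy gs v → Syzygy gs (λ i → r * v i)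
      syzygy-* {gs} {v} r sv = N.≈ᴹ-trans (combine-* N r gs v)
        (N.≈ᴹ-trans (N.*ₗ-cong refl sv) (N.*ₗ-zeroʳ r))

      syzygy-minus : ∀ {gs v w} → Syzygy gs v → Syzygy gs w → Syzygy gs (λ i → v i - w i)
      syzygy-minus {gs} {v} {w} sv sw = N.≈ᴹ-trans (combine-+ N gs v (-_ ∘ w))
        (N.≈ᴹ-trans (N.+ᴹ-cong sv (N.≈ᴹ-trans (combine-neg N gs w) (N.-ᴹ‿cong sw)))
          (N.-ᴹ‿inverseʳ N.0ᴹ))

      span-syzygy : ∀ gs {zs v} → All (Syzygy gs) zs → Span (free A (length gs)) zs v → Syzygy gs v
      span-syzygy gs []       (nil v≈0)               = N.≈ᴹ-trans (combine-cong N gs v≈0) (combine-0 N gs)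
      span-syzygy gs (s ∷ ss) (cons {g = z} {w = w} r _ p v≈) =
        N.≈ᴹ-trans (combine-cong N gs v≈) (N.≈ᴹ-trans (combine-+ N gs (λ i → r * z i) w)
          (N.≈ᴹ-trans (N.+ᴹ-cong (syzygy-* {gs} {z} r s) (span-syzygy gs ss p)) (N.+ᴹ-identityˡ N.0ᴹ)))

      syzygies-sound : ∀ {gs} (q : LinearQuotients N gens gs) → All (Syzygy gs) (syzygies q)
      syzygies-sound []                              = []
      syzygies-sound (quotient {g} {gs} φ _ relations q) =
        Allₚ.++⁺ (lifts-sound relations) (Allₚ.map⁺ (All.map
          (λ s → N.≈ᴹ-trans (N.+ᴹ-cong (N.*ₗ-zeroˡ g) s) (N.+ᴹ-identityˡ N.0ᴹ)) (syzygies-sound q)))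
        where
        lifts-sound : ∀ {xs} (ps : All (λ x → LinearSpan N gs (x N.*ₗ g)) xs) →
                      All (Syzygy (g ∷ gs)) (lifts ps)
        lifts-sound []       = []
        lifts-sound (p ∷ ps) = syzygy-lift p ∷ lifts-sound ps

      -- Subtracting lifts reduces a syzygy of g ∷ gs whose head lies in ⟨ xs ⟩ to one of gs.
      span-lifts : ∀ {g gs zs xs} (ps : All (λ x → LinearSpan N gs (x N.*ₗ g)) xs) →
                   (∀ v → Syzygy gs v → Span (free A (length gs)) zs v) →
                   ∀ v → Syzygy (g ∷ gs) v → Span regular xs (v zero) →
                   Span (free A (suc (length gs))) (lifts ps ++ map (0# V.∷_) zs) v
      span-lifts {g} {gs} [] complete v sv (nil v₀≈0) =
        resp-≈ᴹ (free A _) (λ { zero → sym v₀≈0 ; (suc i) → refl })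
          (combination-map (0∷-linear _) (complete (v ∘ suc)
            (N.≈ᴹ-trans (N.≈ᴹ-sym (N.≈ᴹ-trans
              (N.+ᴹ-cong (N.≈ᴹ-trans (N.*ₗ-cong v₀≈0 N.≈ᴹ-refl) (N.*ₗ-zeroˡ g)) N.≈ᴹ-refl)
              (N.+ᴹ-identityˡ _))) sv)))
      span-lifts {g} {gs} (_∷_ {x = x} p ps) complete v sv (cons {w = u} r _ q v₀≈) =
        cons r tt
          (span-lifts ps complete (λ i → v i - r * s i)
            (syzygy-minus {g ∷ gs} {v} {λ i → r * s i} sv (syzygy-* {g ∷ gs} {s} r (syzygy-lift p)))
            (resp-≈ᴹ regular (sym (trans (+-congʳ v₀≈) (xyx⁻¹≈y (r * x) u))) q))
          (λ i → sym (x+[y-x]≈y (r * s i) (v i)))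
        where
        open AbelianGroupProperties +-abelianGroup using (xyx⁻¹≈y)
        s = x V.∷ -_ ∘ coefficients N p

      syzygies-complete : ∀ {gs} (q : LinearQuotients N gens gs) v → Syzygy gs v →
                          Span (free A (length gs)) (syzygies q) v
      syzygies-complete []                              v sv = nil λ ()
      syzygies-complete (quotient {g} {gs} φ kills relations q) v sv =
        span-lifts relations (syzygies-complete q) v sv
          -- A syzygy expresses `v zero *ₗ g` through `gs`, so `kills` puts its head into the ideal
          -- of `gens φ`.
          (kills (v zero) (resp-≈ᴹ N v₀g≈ (span-combine N gs (-_ ∘ v ∘ suc))))
        where
        open GroupProperties N.+ᴹ-group using (inverseˡ-unique)
        v₀g≈ : combine N gs (-_ ∘ v ∘ suc) N.≈ᴹ v zero N.*ₗ g
        v₀g≈ = N.≈ᴹ-trans (combine-neg N gs (v ∘ suc)) (N.≈ᴹ-sym (inverseˡ-unique _ _ sv))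

      -- Here the relations have to lie in `LinearSpan`: their coefficients have degree 1 like the
      -- colon generators, which keeps the resolution linear.
      lifts-A₁ : ∀ {g gs xs} (ps : All (λ x → LinearSpan N gs (x N.*ₗ g)) xs) → All (Homogeneous 1) xs →
                 All (λ s → ∀ j → Homogeneous 1 (s j)) (lifts ps)
      lifts-A₁ []       []       = []
      lifts-A₁ (p ∷ ps) (x ∷ xs) =
        (λ { zero → x ; (suc j) → homogeneous-neg (coefficients-P N p j) }) ∷ lifts-A₁ ps xs

      syzygies-A₁ : ∀ {gs} (q : LinearQuotients N gens gs) →
                    All (λ s → ∀ j → Homogeneous 1 (s j)) (syzygies q)
      syzygies-A₁ []                         = []
      syzygies-A₁ (quotient φ _ relations q) = Allₚ.++⁺ (lifts-A₁ relations (gens-A₁ φ))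
        (Allₚ.map⁺ (All.map (λ s → λ { zero → homogeneous-0# ; (suc j) → s j }) (syzygies-A₁ q)))

      -- The heads of the lifts are the members of `xs`, and the padded vectors have head 0. This
      -- bounds the colon ideals among the lifts from above.
      span-head : ∀ {g gs xs zs v} (ps : All (λ x → LinearSpan N gs (x N.*ₗ g)) xs) →
                  Span (free A (suc (length gs))) (lifts ps ++ map (0# V.∷_) zs) v →
                  Span regular xs (v zero)
      span-head {zs = []}     []       (nil v≈0)       = nil (v≈0 zero)
      span-head {g} {gs} {zs = z ∷ zs} [] (cons r _ p v≈) with span-head {g} {gs} {zs = zs} [] p
      ... | nil w₀≈0 = nil (trans (v≈ zero) (trans (+-cong (zeroʳ r) w₀≈0) (+-identityˡ 0#)))
      span-head               (_ ∷ ps) (cons r _ p v≈) = cons r tt (span-head ps p) (v≈ zero)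

      -- The lifts inherit the colon ideals of the list `gens φ`, which belong to the family by
      -- `gens-quotients`; the padded syzygies keep theirs by induction. So the construction can be
      -- iterated.
      syzygies-quotients : ∀ {gs} (q : LinearQuotients N gens gs) →
                           LinearQuotients (free A (length gs)) gens (syzygies q)
      syzygies-quotients [] = []
      syzygies-quotients (quotient {g} {gs} φ kills relations q) =
        go relations (gens-A₁ φ) (gens-quotients φ)
        where
        zs = map (0# V.∷_) (syzygies q)
        zs-A₁ : All (λ s → ∀ j → Homogeneous 1 (s j)) zs
        zs-A₁ = Allₚ.map⁺ (All.map (λ s → λ { zero → homogeneous-0# ; (suc j) → s j }) (syzygies-A₁ q))

        go : ∀ {xs} (ps : All (λ x → LinearSpan N gs (x N.*ₗ g)) xs) → All (Homogeneous 1) xs →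
             LinearQuotients regular gens xs →
             LinearQuotients (free A (suc (length gs))) gens (lifts ps ++ zs)
        go []       []       []                         = linearQuotients-map (0∷-linear _) (tail-linear _)
          (λ v i → refl) (syzygies-quotients q)
        go (_∷_ {x = x} p ps) (x₁ ∷ xs₁) (quotient ψ x-kills x-relations qs) =
          quotient ψ
            (λ r s → x-kills r (span-head ps s))
            -- If y x lies in the span of the later generators, then y times the lift `s` of x is a
            -- syzygy with such a head, and `span-lifts` writes it through the later lifts and `zs`.
            -- Its entries have degree 2, so `linearize` makes the coefficients linear.
            (All.zipWith (λ {y} (y₁ , yx) → resp-≈ᴹ (free A _)
                (λ j → π-identity (homogeneous-* y₁ (s₁ j)))
                (linearize (Allₚ.++⁺ (lifts-A₁ ps xs₁) zs-A₁)
                  (span-lifts ps (syzygies-complete q) (λ j → y * s j) (syzygy-* {g ∷ gs} {s} y (syzygy-lift p))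
                    (forget regular yx))))
              (gens-A₁ ψ , x-relations))
            (go ps xs₁ qs)
          where
          s = x V.∷ -_ ∘ coefficients N p
          s₁ : ∀ j → Homogeneous 1 (s j)
          s₁ zero    = x₁
          s₁ (suc j) = homogeneous-neg (coefficients-P N p j)

    -- The linear resolution of the residue field

    record Stage : Set (i ⊔ a ⊔ ℓa ⊔ h) where
      field
        rank         : ℕ
        generators   : List (Vector Carrier rank)
        generators-1 : All (λ g → ∀ j → Homogeneous 1 (g j)) generators
        quotients    : LinearQuotients (free A rank) gens generators
    open Stage

    -- The generators of a stage index the basis of the following free module, and their syzygies
    -- are the columns of the following differential.
    next : Stage → Stage
    next s = record
      { rank         = length (generators s)
      ; generators   = syzygies (quotients s)
      ; generators-1 = syzygies-A₁ (quotients s)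
      ; quotients    = syzygies-quotients (quotients s)
      }

    module _ (φ₀ : Index) (positive : ∀ {x} → A>0 A x → Span regular (gens φ₀) x) where

      stage : ℕ → Stage
      stage zero    = record
        { rank         = 1
        ; generators   = map (λ x _ → x) (gens φ₀)
        ; generators-1 = Allₚ.map⁺ (All.map (λ x₁ _ → x₁) (gens-A₁ φ₀))
        ; quotients    = linearQuotients-map const-linear head-linear (λ _ → refl) (gens-quotients φ₀)
        }
      stage (suc k) = next (stage k)

      gradedFreeResolution : GradedFreeResolution A
      gradedFreeResolution = record
        { rank     = λ k → rank (stage k)
        ; shift    = λ k _ → k
        ; ∂        = λ k → combine (free A (rank (stage k))) (generators (stage k))
        ; ∂-linear = λ k → combine-isLeftModuleHomomorphism (rank (stage k)) (generators (stage k))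
        ; ∂-graded = λ k {d} {v} hv j → ≡.subst (λ e → Homogeneousℤ e _) (suc-⊖-suc d k)
            (combine-graded (d ℤ.⊖ suc k) (generators (stage k)) v (generators-1 (stage k)) hv j)
        -- The residue field has the carrier of `A` with a coarser equality, so the quotient map
        -- acts as the identity on the single coordinate.
        ; ε        = λ v → v zero
        ; ε-linear = record
          { +ᴹ-isGroupHomomorphism = record
            { isMonoidHomomorphism = record
              { isMagmaHomomorphism = record
                { isRelHomomorphism = record { cong = λ v≈w → ≈⇒≈ᴹ (v≈w zero) }
                ; homo = λ v w → R.≈ᴹ-refl
                }
              ; ε-homo = R.≈ᴹ-refl
              }
            ; ⁻¹-homo = λ v → R.≈ᴹ-refl
            }
          ; *ₗ-homo = λ r v → R.≈ᴹ-refl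
          }
        ; ε-graded     = λ {d} {v} hv → v zero , lower (hv zero) , R.≈ᴹ-refl
        ; ε-surjective = λ x → (λ _ → x) , R.≈ᴹ-refl
        -- Equality with 0 in the residue field means that the difference lies in `A>0`, which by
        -- `positive` is spanned by `gens φ₀`, the entries of `∂ 0`.
        ; exact₀ = λ v → mk⇔
            (λ v₀≈0 → let p = combination-map const-linear (positive (resp (x-0≈x (v zero)) v₀≈0)) in
              coefficients (free A 1) p ,
              λ { zero → combine-coefficients (free A 1) p zero })
            (λ (w , ∂w≈v) → resp (sym (x-0≈x (v zero))) (span⇒A>0 (gens-A₁ φ₀)
              (resp-≈ᴹ regular (∂w≈v zero)
                (combination-unmap const-linear head-linear (λ _ → refl) (gens φ₀)
                  (span-combine (free A 1) (map (λ x _ → x) (gens φ₀)) w)))))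
        ; exact = λ k v → mk⇔
            (λ ∂v≈0 → let p = syzygies-complete {N = free A (rank (stage k))} (quotients (stage k)) v ∂v≈0 in
              coefficients (free A _) p , combine-coefficients (free A _) p)
            (λ (w , ∂w≈v) → span-syzygy {N = free A (rank (stage k))} (generators (stage k)) (syzygies-sound (quotients (stage k)))
              (resp-≈ᴹ (free A _) ∂w≈v (span-combine (free A _) (generators (stage (suc k))) w)))
        }
        where
        module R = LeftModule (residueField A)
        ≈⇒≈ᴹ : ∀ {x y} → x ≈ y → x R.≈ᴹ y
        ≈⇒≈ᴹ {x} {y} x≈y = resp (sym (trans (+-congʳ x≈y) (-‿inverseʳ y))) null
        x-0≈x : ∀ x → x - 0# ≈ x
        x-0≈x x = trans (+-congˡ -0#≈0#) (+-identityʳ x)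
        suc-⊖-suc : ∀ d k → ℤ.suc (d ℤ.⊖ suc k) ≡ d ℤ.⊖ k
        suc-⊖-suc d k = ≡.trans (ℤₚ.distribʳ-⊖-+-pos 1 d (suc k)) (ℤₚ.[1+m]⊖[1+n]≡m⊖n d k)

      koszul : StandardGraded A → Koszul A
      koszul standard = standard , gradedFreeResolution , λ _ _ → ≡.refl

-- Monoid algebras

module MonomialIdeals {c ℓ m ℓm : Level} (K : CommutativeRing c ℓ)
  (M : CommutativeMonoid m ℓm)
  (_≟_ : Decidable (CommutativeMonoid._≈_ M))
  (degree : CommutativeMonoid.Carrier M → ℕ)
  (degree-isMonoidHomomorphism :
    IsMonoidHomomorphism (CommutativeMonoid.rawMonoid M) ℕ.+-0-rawMonoid degree)
  where

  private
    module K = CommutativeRing K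
    module M = CommutativeMonoid M
    module KM = MonoidAlgebra K M _≟_ degree degree-isMonoidHomomorphism
    module A = GradedAlgebra KM.gradedAlgebra
    module degree = IsMonoidHomomorphism degree-isMonoidHomomorphism
    module ≈-Reasoning = SetoidReasoning K.setoid
  open M using (_∙_)
  open KM using (gradedAlgebra; lin; δ; coefficient; component; Homogeneous)
  open KoszulFiltrations gradedAlgebra
  open Combinations

  -- Graded components in a monoid algebra

  restrict : ℕ → (M.Carrier → K.Carrier) → M.Carrier → K.Carrier
  restrict d φ x = if does (degree x ℕ.≟ d) then φ x else K.0#

  restrict-cong : ∀ d {φ} → KM.Congruent φ → KM.Congruent (restrict d φ)
  restrict-cong d φ-cong {x} {y} x≈y rewrite degree.⟦⟧-cong x≈y with does (degree y ℕ.≟ d)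
  ... | true  = φ-cong x≈y
  ... | false = K.refl

  -- The selection of terms is moved from the list to the functional. The restricted functional is
  -- still congruent, hence respects equality of formal sums, and therefore so does `component`.
  lin-component : ∀ d φ xs → lin φ (component d xs) K.≈ lin (restrict d φ) xs
  lin-component d φ []             = K.refl
  lin-component d φ ((a , x) ∷ xs) with does (degree x ℕ.≟ d)
  ... | true  = K.+-congˡ (lin-component d φ xs)
  ... | false = K.trans (lin-component d φ xs) (K.sym (K.trans (K.+-congʳ (K.zeroʳ a)) (K.+-identityˡ _)))

  component-cong : ∀ d {xs ys} → xs A.≈ ys → component d xs A.≈ component d ys
  component-cong d {xs} {ys} xs≈ys z = K.trans (lin-component d (δ z) xs)
    (K.trans (KM.lin-resp (restrict-cong d (KM.δ-cong z)) {xs} {ys} xs≈ys)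
      (K.sym (lin-component d (δ z) ys)))

  private
    degree? : ∀ d (t : K.Carrier × M.Carrier) → Dec (degree (proj₂ t) ≡ d)
    degree? d (a , x) = degree x ℕ.≟ d

  -- All terms of `ys` have degree `e`, so by cancellation in ℕ a product of terms has degree
  -- `d + e` exactly when its left factor has degree `d`.
  component-* : ∀ d {e} xs ys → All (λ (a , y) → degree y ≡ e) ys →
                component (d ℕ.+ e) (xs KM.* ys) ≡ component d xs KM.* ys
  component-* d     []             ys ps = ≡.refl
  component-* d {e} ((a , x) ∷ xs) ys ps =
    ≡.trans (filter-++ (degree? (d ℕ.+ e)) (map (λ (b , y) → a K.* b , x ∙ y) ys) (xs KM.* ys))
      (≡.trans (≡.cong (component (d ℕ.+ e) (map (λ (b , y) → a K.* b , x ∙ y) ys) ++_) (component-* d xs ys ps))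
        term)
    where
    term : component (d ℕ.+ e) (map (λ (b , y) → a K.* b , x ∙ y) ys) ++ component d xs KM.* ys
           ≡ component d ((a , x) ∷ xs) KM.* ys
    term with degree x ℕ.≟ d
    ... | yes x≡d = ≡.trans (≡.cong (_++ component d xs KM.* ys)
      (filter-all (degree? (d ℕ.+ e)) (Allₚ.map⁺ (All.map
        (λ { {_ , y} y≡e → ≡.trans (degree.homo x y) (≡.cong₂ ℕ._+_ x≡d y≡e) }) ps))))
      (≡.cong (KM._* ys) (≡.sym (filter-accept (degree? d) x≡d)))
    ... | no  x≢d = ≡.trans (≡.cong (_++ component d xs KM.* ys)
      (filter-none (degree? (d ℕ.+ e)) (Allₚ.map⁺ (All.map
        (λ { {_ , y} ≡.refl x∙y≡d+e → x≢d (ℕₚ.+-cancelʳ-≡ (degree y) (degree x) d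
          (≡.trans (≡.sym (degree.homo x y)) x∙y≡d+e)) }) ps))))
      (≡.cong (KM._* ys) (≡.sym (filter-reject (degree? d) x≢d)))

  components : Components
  components = record
    { π             = component
    ; π-cong        = λ d {xs} {ys} → component-cong d {xs} {ys}
    ; π-+           = λ d xs ys → A.reflexive (filter-++ (degree? d) xs ys)
    ; π-homogeneous = λ d xs → component d xs , Allₚ.all-filter (degree? d) xs ,
                               A.refl {component d xs}
    ; π-identity    = λ { {d} {xs} (ys , ps , xs≈ys) → A.trans {component d xs} {ys} {xs}
        (A.trans {component d xs} {component d ys} {ys} (component-cong d {xs} {ys} xs≈ys)
          (A.reflexive (filter-all (degree? d) ps)))
        (A.sym {xs} {ys} xs≈ys) }
    ; π-*           = λ { d {e} xs {ys} (zs , ps , ys≈zs) →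
        A.trans {component (d ℕ.+ e) (xs KM.* ys)} {component (d ℕ.+ e) (xs KM.* zs)} {component d xs KM.* ys}
          (component-cong (d ℕ.+ e) {xs KM.* ys} {xs KM.* zs}
            (KM.*-cong {xs} {xs} {ys} {zs} (A.refl {xs}) ys≈zs))
          (A.trans {component (d ℕ.+ e) (xs KM.* zs)} {component d xs KM.* zs} {component d xs KM.* ys}
            (A.reflexive (component-* d xs zs ps))
            (KM.*-cong {component d xs} {component d xs} {zs} {ys} (A.refl {component d xs}) (A.sym {ys} {zs} ys≈zs))) }
    }

  -- Monomial ideals

  Multiple : ∀ {p} → (M.Carrier → Set p) → List M.Carrier → M.Carrier → Set (m ⊔ ℓm ⊔ p)
  Multiple P gs z = Any (λ g → ∃[ w ] P w × w ∙ g M.≈ z) gs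

  InIdeal : List M.Carrier → M.Carrier → Set (m ⊔ ℓm)
  InIdeal = Multiple (λ _ → ⊤)

  t^ : M.Carrier → KM.Carrier
  t^ x = (K.1# , x) ∷ []

  t^-A₁ : ∀ {x} → degree x ≡ 1 → Homogeneous 1 (t^ x)
  t^-A₁ {x} x₁ = t^ x , (x₁ ∷ []) , A.refl {t^ x}

  coefficient-*t^ : ∀ xs x z → coefficient z (xs KM.* t^ x) K.≈ lin (λ u → δ z (u ∙ x)) xs
  coefficient-*t^ xs x z = K.trans (KM.lin-* (δ z) xs (t^ x))
    (KM.lin-cong (λ u → K.trans (K.+-identityʳ _) (K.*-identityˡ _)) xs)

  term-*t^ : ∀ a w x z → w ∙ x M.≈ z → ((a , z) ∷ []) A.≈ ((a , w) ∷ []) KM.* t^ x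
  term-*t^ a w x z w∙x≈z y = K.+-congʳ (K.*-cong (K.sym (K.*-identityʳ a)) (KM.δ-cong y (M.sym w∙x≈z)))

  -- The monomial t^z occurs in r t^g only if g divides z. Together with `span-coefficient` this
  -- makes membership in a monomial ideal a condition on coefficients alone.
  coefficient-span : ∀ gs {xs} → Span regular (map t^ gs) xs → ∀ z → ¬ InIdeal gs z →
                     coefficient z xs K.≈ K.0#
  coefficient-span []       (nil xs≈0)                 z z∉ = xs≈0 z
  coefficient-span (g ∷ gs) {xs} (cons {w = ys} r _ p xs≈) z z∉ = begin
    coefficient z xs                                 ≈⟨ xs≈ z ⟩
    coefficient z (r KM.* t^ g KM.+ ys)              ≈⟨ KM.lin-+ (δ z) (r KM.* t^ g) ys ⟩
    coefficient z (r KM.* t^ g) K.+ coefficient z ys ≈⟨ K.+-cong (coefficient-*t^ r g z)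
                                                          (coefficient-span gs p z (z∉ ∘ there)) ⟩
    lin (λ u → δ z (u ∙ g)) r K.+ K.0#               ≈⟨ K.+-identityʳ _ ⟩
    lin (λ u → δ z (u ∙ g)) r
      ≈⟨ KM.lin-cong (λ u → KM.δ-0 (λ z≈ug → z∉ (here (u , tt , M.sym z≈ug)))) r ⟩
    lin (λ u → K.0#) r                               ≈⟨ KM.lin-0 r ⟩
    K.0#                                             ∎
    where open ≈-Reasoning

  combination-term : ∀ {p q} {P : M.Carrier → Set p} {Q : KM.Carrier → Set q} a →
                     (∀ {w} → P w → Q ((a , w) ∷ [])) → Q [] →
                     ∀ {gs z} → Multiple P gs z → Combination regular Q (map t^ gs) ((a , z) ∷ [])
  combination-term a P⇒Q q0 {g ∷ gs} {z} (here (w , pw , w∙g≈z)) =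
    cons ((a , w) ∷ []) (P⇒Q pw) (combination-0 regular q0 (map t^ gs)) (term-*t^ a w g z w∙g≈z)
  combination-term a P⇒Q q0 (there i) =
    cons [] q0 (combination-term a P⇒Q q0 i) (λ _ → K.refl)

  span-terms : ∀ {gs} xs → All (λ (a , z) → InIdeal gs z) xs → Span regular (map t^ gs) xs
  span-terms {gs} []             []       = combination-0 regular tt (map t^ gs)
  span-terms      ((a , z) ∷ xs) (p ∷ ps) = span-+ regular (combination-term a (λ _ → tt) tt p) (span-terms xs ps)

  module _ {gs : List M.Carrier} (inIdeal? : ∀ z → Dec (InIdeal gs z)) where

    private
      ∈? : ∀ (t : K.Carrier × M.Carrier) → Dec (InIdeal gs (proj₂ t))
      ∈? (a , z) = inIdeal? z

    lin-filter : ∀ φ xs → (∀ z → ¬ InIdeal gs z → φ z K.≈ K.0#) → lin φ xs K.≈ lin φ (filter ∈? xs)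
    lin-filter φ []             φ≈0 = K.refl
    lin-filter φ ((a , z) ∷ xs) φ≈0 with inIdeal? z
    ... | yes _  = K.+-congˡ (lin-filter φ xs φ≈0)
    ... | no  z∉ = K.trans (K.+-cong (K.trans (K.*-congˡ (φ≈0 z z∉)) (K.zeroʳ a)) (lin-filter φ xs φ≈0))
                           (K.+-identityˡ _)

    inIdeal-resp : ∀ {y z} → y M.≈ z → InIdeal gs y → InIdeal gs z
    inIdeal-resp y≈z = Any.map λ (w , _ , w∙g≈y) → w , tt , M.trans w∙g≈y y≈z

    -- A formal sum may contain cancelling terms outside the ideal. Discarding them leaves an equal
    -- sum whose terms are all multiples of generators.
    span-coefficient : ∀ xs → (∀ z → ¬ InIdeal gs z → coefficient z xs K.≈ K.0#) → Span regular (map t^ gs) xs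
    span-coefficient xs xs∉≈0 = resp-≈ᴹ regular (A.sym {xs} {filter ∈? xs} xs≈)
      (span-terms (filter ∈? xs) (Allₚ.all-filter ∈? xs))
      where
      xs≈ : xs A.≈ filter ∈? xs
      xs≈ z with inIdeal? z
      ... | yes z∈ = lin-filter (δ z) xs (λ y y∉ → KM.δ-0 (λ z≈y → y∉ (inIdeal-resp z≈y z∈)))
      ... | no  z∉ = K.trans (xs∉≈0 z z∉) (K.sym (coefficient-span gs
        (span-terms (filter ∈? xs) (Allₚ.all-filter ∈? xs)) z z∉))

  -- The combinatorial counterpart of `LinearQuotients`: the colon ideal is tested on exponents, and
  -- linear relations become cofactors of degree 1.
  data MonomialQuotients {i : Level} {Index : Set i} (gens : Index → List M.Carrier) :
                         List M.Carrier → Set (i ⊔ m ⊔ ℓm) where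
    []       : MonomialQuotients gens []
    quotient : ∀ {x xs} φ → (∀ z → InIdeal xs (z ∙ x) → InIdeal (gens φ) z) →
               All (λ u → Multiple (λ w → degree w ≡ 1) xs (u ∙ x)) (gens φ) →
               MonomialQuotients gens xs → MonomialQuotients gens (x ∷ xs)

  -- By cancellation, the coefficient of t^(z∙x) in r t^x is that of t^z in r. So if r t^x lies in a
  -- monomial ideal, the exponents of r can be tested one at a time.
  monomial⇒linearQuotients :
    (∀ {x y z} → x ∙ z M.≈ y ∙ z → x M.≈ y) →
    ∀ {i} {Index : Set i} {gens : Index → List M.Carrier} → (∀ φ z → Dec (InIdeal (gens φ) z)) →
    ∀ {xs} → MonomialQuotients gens xs → LinearQuotients regular (map t^ ∘ gens) (map t^ xs)
  monomial⇒linearQuotients cancel dec []                            = []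
  monomial⇒linearQuotients cancel {gens = gens} dec (quotient {x} {xs} φ colon relations q) =
    quotient φ
      (λ r p → span-coefficient (dec φ) r λ z z∉ → K.trans (K.sym (coefficient-∙x r z))
        (coefficient-span xs p (z ∙ x) (z∉ ∘ colon z)))
      (Allₚ.map⁺ (All.map (λ {u} μ → resp-≈ᴹ regular (A.sym {t^ u KM.* t^ x} {t^ (u ∙ x)} (t^-∙ u))
          (combination-term K.1# t^-A₁ (A.homogeneous-0# {1}) μ))
        relations))
      (monomial⇒linearQuotients cancel dec q)
    where
    coefficient-∙x : ∀ r z → coefficient (z ∙ x) (r KM.* t^ x) K.≈ coefficient z r
    coefficient-∙x r z = K.trans (coefficient-*t^ r x (z ∙ x)) (KM.lin-cong δ-∙x r)
      where
      δ-∙x : ∀ u → δ (z ∙ x) (u ∙ x) K.≈ δ z u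
      δ-∙x u with z ≟ u
      ... | yes z≈u = KM.δ-1 (M.∙-congʳ z≈u)
      ... | no  z≉u = KM.δ-0 (z≉u ∘ cancel)
    t^-∙ : ∀ u → t^ u KM.* t^ x A.≈ t^ (u ∙ x)
    t^-∙ u z = K.+-congʳ (K.*-congʳ (K.*-identityˡ K.1#))

  -- M is embedded in ℕ^{n+1} by coord, with the degree as coordinate 0, and is closed under
  -- z ↦ min(b, z) and z ↦ z - min(b, z). Degree 1 elements are listed so that
  -- none is preceded by a larger one.
  record Truncations (n : ℕ) : Set (m ⊔ ℓm) where
    field
      coord           : M.Carrier → Vector ℕ (suc n)
      coord-cong      : ∀ {x y} → x M.≈ y → ∀ j → coord x j ≡ coord y j
      coord-injective : ∀ {x y} → (∀ j → coord x j ≡ coord y j) → x M.≈ y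
      coord-∙         : ∀ x y j → coord (x ∙ y) j ≡ coord x j ℕ.+ coord y j
      coord-degree    : ∀ x → coord x zero ≡ degree x
      degree-0        : ∀ x → degree x ≡ 0 → ∀ j → coord x j ≡ 0
      b               : Vector ℕ (suc n)
      b-degree        : b zero ≡ 1
      b>0             : ∀ j → 0 ℕ.< b j
      truncate        : M.Carrier → M.Carrier
      remainder       : M.Carrier → M.Carrier
      coord-truncate  : ∀ z j → coord (truncate z) j ≡ b j ⊓ coord z j
      coord-remainder : ∀ z j → coord (remainder z) j ≡ coord z j ∸ b j
      box             : List M.Carrier
      box-degree      : All (λ x → degree x ≡ 1) box
      box-complete    : ∀ x → degree x ≡ 1 → Any (x M.≈_) box
      box-increasing  : AllPairs (λ x y → ¬ (∀ j → coord y j ℕ.≤ coord x j)) box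

  -- The Koszul filtration by supports

  module _ {n : ℕ} (T : Truncations n) where

    open Truncations T

    cancelʳ : ∀ {x y z} → x ∙ z M.≈ y ∙ z → x M.≈ y
    cancelʳ {x} {y} {z} xz≈yz = coord-injective λ j → ℕₚ.+-cancelʳ-≡ (coord z j) _ _
      (≡.trans (≡.sym (coord-∙ x z j)) (≡.trans (coord-cong xz≈yz j) (coord-∙ y z j)))

    remainder∙truncate : ∀ z → remainder z ∙ truncate z M.≈ z
    remainder∙truncate z = coord-injective λ j → begin
      coord (remainder z ∙ truncate z) j                  ≡⟨ coord-∙ (remainder z) (truncate z) j ⟩
      coord (remainder z) j ℕ.+ coord (truncate z) j      ≡⟨ ≡.cong₂ ℕ._+_ (coord-remainder z j) (coord-truncate z j) ⟩
      (coord z j ∸ b j) ℕ.+ (b j ⊓ coord z j)             ≡⟨ ℕₚ.+-comm (coord z j ∸ b j) _ ⟩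
      (b j ⊓ coord z j) ℕ.+ (coord z j ∸ b j)             ≡⟨ ℕₚ.m⊓n+n∸m≡n (b j) (coord z j) ⟩
      coord z j                                           ∎
      where open ≡.≡-Reasoning

    degree-remainder : ∀ {d} z → degree z ≡ suc d → degree (remainder z) ≡ d
    degree-remainder {d} z z≡ = begin
      degree (remainder z)     ≡⟨ coord-degree (remainder z) ⟨
      coord (remainder z) zero ≡⟨ coord-remainder z zero ⟩
      coord z zero ∸ b zero    ≡⟨ ≡.cong₂ _∸_ (≡.trans (coord-degree z) z≡) b-degree ⟩
      d                        ∎
      where open ≡.≡-Reasoning

    degree-truncate : ∀ {d} z → degree z ≡ suc d → degree (truncate z) ≡ 1
    degree-truncate {d} z z≡ = begin
      degree (truncate z)     ≡⟨ coord-degree (truncate z) ⟨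
      coord (truncate z) zero ≡⟨ coord-truncate z zero ⟩
      b zero ⊓ coord z zero   ≡⟨ ≡.cong₂ _⊓_ b-degree (≡.trans (coord-degree z) z≡) ⟩
      1                       ∎
      where open ≡.≡-Reasoning

    -- The remainder of an element of degree 1 has degree 0, which forces all its coordinates to
    -- vanish.
    degree-1 : ∀ x → degree x ≡ 1 → ∀ j → coord x j ℕ.≤ b j
    degree-1 x x≡1 j = ℕₚ.m∸n≡0⇒m≤n (≡.trans (≡.sym (coord-remainder x j))
      (degree-0 (remainder x) (degree-remainder x x≡1) j))

    -- This is membership in the ideal I_S. Subsets are Boolean so that `meets?`, and with it ideal
    -- membership, is decidable.
    Meets : (Fin (suc n) → Bool) → M.Carrier → Set
    Meets S z = ∃[ j ] Bool.T (S j) × 0 ℕ.< coord z j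

    meets? : ∀ S z → Dec (Meets S z)
    meets? S z = Finₚ.any? λ j → T? (S j) ×-dec (0 ℕₚ.<? coord z j)

    meets⇒degree>0 : ∀ {S} z → Meets S z → ∃[ d ] degree z ≡ suc d
    meets⇒degree>0 z (j , _ , 0<zⱼ) with degree z in z≡
    ... | zero  = contradiction (degree-0 z z≡ j) (ℕₚ.m<n⇒n≢0 0<zⱼ)
    ... | suc d = d , ≡.refl

    meets-truncate : ∀ {S} z → Meets S z → Meets S (truncate z)
    meets-truncate z (j , Sj , 0<zⱼ) =
      j , Sj , ≡.subst (0 ℕ.<_) (≡.sym (coord-truncate z j)) (ℕₚ.⊓-pres-m< (b>0 j) 0<zⱼ)

    meets-cong : ∀ {S x y} → x M.≈ y → Meets S x → Meets S y
    meets-cong x≈y (j , Sj , 0<xⱼ) = j , Sj , ≡.subst (0 ℕ.<_) (coord-cong x≈y j) 0<xⱼ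

    meets-∙ʳ : ∀ {S} x y → Meets S y → Meets S (x ∙ y)
    meets-∙ʳ x y (j , Sj , 0<yⱼ) = j , Sj , ≡.subst (0 ℕ.<_) (≡.sym (coord-∙ x y j))
      (ℕₚ.≤-trans 0<yⱼ (ℕₚ.m≤n+m (coord y j) (coord x j)))

    gens : (Fin (suc n) → Bool) → List M.Carrier
    gens S = filter (meets? S) box

    gens-complete : ∀ S x → degree x ≡ 1 → Meets S x → Any (x M.≈_) (gens S)
    gens-complete S x x≡1 Sx with Anyₚ.filter⁺ (meets? S) (box-complete x x≡1)
    ... | inj₁ i  = i
    ... | inj₂ ¬S = contradiction (meets-cong (Anyₚ.lookup-result (box-complete x x≡1)) Sx) ¬S

    -- The truncation of `z` has degree 1, still meets `S` because every `b j` is positive, and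
    -- divides `z` with the remainder as cofactor.
    meets⇒inIdeal : ∀ S z → Meets S z → InIdeal (gens S) z
    meets⇒inIdeal S z Sz with meets⇒degree>0 z Sz
    ... | d , z≡ = Any.map
      (λ t≈g → remainder z , tt , M.trans (M.∙-congˡ (M.sym t≈g)) (remainder∙truncate z))
      (gens-complete S (truncate z) (degree-truncate z z≡) (meets-truncate z Sz))

    inIdeal⇒meets : ∀ S z → InIdeal (gens S) z → Meets S z
    inIdeal⇒meets S z = All.lookupWith
      (λ { {g} Sg (w , _ , wg≈z) → meets-cong wg≈z (meets-∙ʳ w g Sg) })
      (Allₚ.all-filter (meets? S) box)

    inIdeal? : ∀ S z → Dec (InIdeal (gens S) z)
    inIdeal? S z = map′ (meets⇒inIdeal S z) (inIdeal⇒meets S z) (meets? S z)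

    -- The coordinates j for which z_j > 0 forces min(b, z + x) ≠ x.
    free-coordinates : M.Carrier → Fin (suc n) → Bool
    free-coordinates x j = ⌊ coord x j ℕₚ.<? b j ⌋

    -- The last hypothesis of `go` is an invariant: the list contains every degree 1 element of I_S
    -- above one of its members. It survives removal of the head because no later element lies below
    -- the head.
    gens-quotients : ∀ S → MonomialQuotients gens (gens S)
    gens-quotients S = go (gens S)
      (All.zip (Allₚ.filter⁺ (meets? S) box-degree , Allₚ.all-filter (meets? S) box))
      (AllPairsₚ.filter⁺ (meets? S) box-increasing)
      (All.universal (λ x g g≡1 Sg x≤g → gens-complete S g g≡1 Sg) (gens S))
      where
      go : ∀ xs → All (λ x → degree x ≡ 1 × Meets S x) xs →
           AllPairs (λ x y → ¬ (∀ j → coord y j ℕ.≤ coord x j)) xs →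
           All (λ x → ∀ g → degree g ≡ 1 → Meets S g → (∀ j → coord x j ℕ.≤ coord g j) → Any (g M.≈_) xs) xs →
           MonomialQuotients gens xs
      go []       []                  []             []              = []
      go (x ∷ xs) ((x≡1 , Sx) ∷ xs∈S) (x≱xs ∷ xs-inc) (x-up ∷ xs-up) =
        quotient (free-coordinates x) colon
          (All.zipWith (λ {u} (u≡1 , xu) → relation u u≡1 xu)
            (Allₚ.filter⁺ (meets? _) box-degree , Allₚ.all-filter (meets? (free-coordinates x)) box))
          (go xs xs∈S xs-inc (All.zipWith
            (λ (x≱y , y-up) g g≡1 Sg y≤g → drop-head x≱y y≤g (y-up g g≡1 Sg y≤g)) (x≱xs , xs-up)))
        where
        drop-head : ∀ {y g} → ¬ (∀ j → coord y j ℕ.≤ coord x j) → (∀ j → coord y j ℕ.≤ coord g j) →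
                    Any (g M.≈_) (x ∷ xs) → Any (g M.≈_) xs
        drop-head {y} x≱y y≤g (here g≈x) =
          contradiction (λ j → ≡.subst (coord y j ℕ.≤_) (coord-cong g≈x j) (y≤g j)) x≱y
        drop-head x≱y y≤g (there i)  = i

        colon : ∀ z → InIdeal xs (z ∙ x) → InIdeal (gens (free-coordinates x)) z
        colon z i with meets? (free-coordinates x) z
        ... | yes xz = meets⇒inIdeal (free-coordinates x) z xz
        -- Here `z` vanishes wherever `x` is below `b`, and elsewhere `x` already reaches the bound
        -- on degree 1 elements. So any g in `xs` dividing z ∙ x satisfies g ≤ x, against the order
        -- of the list.
        ... | no ¬xz = contradiction i (Allₚ.All¬⇒¬Any (All.zipWith
          (λ { {g} (x≱g , g≡1 , _) (w , _ , wg≈zx) → x≱g (g≤x g g≡1 w wg≈zx) }) (x≱xs , xs∈S)))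
          where
          g≤x : ∀ g → degree g ≡ 1 → ∀ w → w ∙ g M.≈ z ∙ x → ∀ j → coord g j ℕ.≤ coord x j
          g≤x g g≡1 w wg≈zx j with coord x j ℕₚ.<? b j
          ... | no  x≮b = ℕₚ.≤-trans (degree-1 g g≡1 j) (ℕₚ.≮⇒≥ x≮b)
          ... | yes x<b = begin
            coord g j                 ≤⟨ ℕₚ.m≤n+m (coord g j) (coord w j) ⟩
            coord w j ℕ.+ coord g j   ≡⟨ coord-∙ w g j ⟨
            coord (w ∙ g) j           ≡⟨ coord-cong wg≈zx j ⟩
            coord (z ∙ x) j           ≡⟨ coord-∙ z x j ⟩
            coord z j ℕ.+ coord x j   ≡⟨ ≡.cong (ℕ._+ coord x j) zⱼ≡0 ⟩
            coord x j                 ∎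
            where
            open ℕₚ.≤-Reasoning
            zⱼ≡0 : coord z j ≡ 0
            zⱼ≡0 with coord z j in zⱼ≡
            ... | zero  = ≡.refl
            ... | suc _ = contradiction
              (j , fromWitness x<b , ≡.subst (0 ℕ.<_) (≡.sym zⱼ≡) (ℕ.s≤s ℕ.z≤n)) ¬xz

        -- The truncation of u ∙ x is above x, strictly at a coordinate where x is below `b` and u
        -- is positive. So it is a member of `xs`, and its cofactor, the remainder, has degree 2 -
        -- 1.
        relation : ∀ u → degree u ≡ 1 → Meets (free-coordinates x) u → Multiple (λ w → degree w ≡ 1) xs (u ∙ x)
        relation u u≡1 (j , xj , 0<uⱼ) = Any.map
          (λ g≈y → remainder (u ∙ x) , degree-remainder (u ∙ x) ux≡2 ,
                   M.trans (M.∙-congˡ (M.sym g≈y)) (remainder∙truncate (u ∙ x)))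
          (proper (x-up g (degree-truncate (u ∙ x) ux≡2) (meets-truncate (u ∙ x) (meets-∙ʳ u x Sx)) x≤g))
          where
          g = truncate (u ∙ x)
          ux≡2 : degree (u ∙ x) ≡ 2
          ux≡2 = ≡.trans (degree.homo u x) (≡.cong₂ ℕ._+_ u≡1 x≡1)
          g≡ : ∀ j → coord g j ≡ b j ⊓ (coord u j ℕ.+ coord x j)
          g≡ j = ≡.trans (coord-truncate (u ∙ x) j) (≡.cong (b j ⊓_) (coord-∙ u x j))
          x≤g : ∀ j → coord x j ℕ.≤ coord g j
          x≤g j = ≡.subst (coord x j ℕ.≤_) (≡.sym (g≡ j))
            (ℕₚ.⊓-glb (degree-1 x x≡1 j) (ℕₚ.m≤n+m (coord x j) (coord u j)))
          xⱼ<gⱼ : coord x j ℕ.< coord g j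
          xⱼ<gⱼ = ≡.subst (coord x j ℕ.<_) (≡.sym (g≡ j))
            (ℕₚ.⊓-pres-m< (toWitness xj) (ℕₚ.+-monoˡ-≤ (coord x j) 0<uⱼ))
          proper : Any (g M.≈_) (x ∷ xs) → Any (g M.≈_) xs
          proper (here g≈x) = contradiction (≡.sym (coord-cong g≈x j)) (ℕₚ.<⇒≢ xⱼ<gⱼ)
          proper (there i)  = i

    standardGraded : StandardGraded gradedAlgebra
    standardGraded = record
      { η-injective   = λ {a} {a′} ηa≈ηa′ → K.trans (K.sym (coefficient-η a)) (K.trans (ηa≈ηa′ M.ε) (coefficient-η a′))
      ; A₀⊆η          = λ { {xs} (ys , ps , xs≈ys) →
          -- In degree 0 every exponent equals `M.ε`, so the constant is the sum of all
          -- coefficients.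
          lin (λ _ → K.1#) ys , λ z → K.trans (K.+-identityʳ _) (K.sym (K.trans (xs≈ys z) (constant z ys ps))) }
      ; size          = length box
      ; generators    = λ i → t^ (lookup box i)
      ; generators-A₁ = λ i → t^-A₁ (All.lookup box-degree (∈-lookup i))
      ; generates     = generates
      }
      where
      coefficient-η : ∀ a → coefficient M.ε (KM.η a) K.≈ a
      coefficient-η a = K.trans (K.+-identityʳ _) (K.trans (K.*-congˡ (KM.δ-1 M.refl)) (K.*-identityʳ a))

      degree-0⇒ε : ∀ x → degree x ≡ 0 → x M.≈ M.ε
      degree-0⇒ε x x≡0 = coord-injective λ j →
        ≡.trans (degree-0 x x≡0 j) (≡.sym (degree-0 M.ε degree.ε-homo j))

      constant : ∀ z ys → All (λ (a , y) → degree y ≡ 0) ys →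
                 coefficient z ys K.≈ lin (λ _ → K.1#) ys K.* δ z M.ε
      constant z []             []       = K.sym (K.zeroˡ _)
      constant z ((a , y) ∷ ys) (p ∷ ps) = K.trans
        (K.+-cong (K.*-cong (K.sym (K.*-identityʳ a)) (KM.δ-cong z (degree-0⇒ε y p))) (constant z ys ps))
        (K.sym (K.distribʳ _ _ _))

      Gen = Generated gradedAlgebra (λ i → t^ (lookup box i))

      t^-cong : ∀ {x y} → x M.≈ y → t^ x A.≈ t^ y
      t^-cong x≈y z = K.+-congʳ (K.*-congˡ (KM.δ-cong z x≈y))

      -- Splitting off the truncation lowers the degree by one, down to `M.ε`.
      t^-generated : ∀ d z → degree z ≡ d → Gen (t^ z)
      t^-generated zero    z z≡ = resp {x = t^ M.ε} {y = t^ z} (t^-cong (M.sym (degree-0⇒ε z z≡))) (scalar K.1#)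
      t^-generated (suc d) z z≡ = resp (A.sym {t^ z} {t^ (remainder z) KM.* t^ (truncate z)} (term-*t^ K.1# (remainder z) (truncate z) z (remainder∙truncate z)))
        (times (t^-generated d (remainder z) (degree-remainder z z≡))
          (resp {x = t^ (lookup box (Any.index i))} {y = t^ (truncate z)}
            (t^-cong (M.sym (Anyₚ.lookup-index i))) (generator (Any.index i))))
        where i = box-complete (truncate z) (degree-truncate z z≡)

      generates : ∀ xs → Gen xs
      generates []             = resp (λ z → K.trans (K.+-identityʳ _) (K.zeroˡ _)) (scalar K.0#)
      generates ((a , z) ∷ xs) = plus
        (resp (A.sym {(a , z) ∷ []} {KM.η a KM.* t^ z} (term-*t^ a M.ε z z (M.identityˡ z)))
          (times (scalar a) (t^-generated (degree z) z ≡.refl)))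
        (generates xs)

    koszul : Koszul gradedAlgebra
    koszul = Resolution.koszul components (map t^ ∘ gens) gens-A₁
      (λ S → monomial⇒linearQuotients cancelʳ inIdeal? (gens-quotients S))
      everything positive standardGraded
      where
      everything : Fin (suc n) → Bool
      everything _ = true

      gens-A₁ : ∀ S → All (A.Homogeneous 1) (map t^ (gens S))
      gens-A₁ S = Allₚ.map⁺ (All.map t^-A₁ (Allₚ.filter⁺ (meets? S) box-degree))

      positive : ∀ {xs} → A>0 gradedAlgebra xs → Span regular (map t^ (gens everything)) xs
      positive (homogeneous {k} {xs} (ys , ps , xs≈ys)) = resp-≈ᴹ regular (A.sym {xs} {ys} xs≈ys)
        (span-terms ys (All.map (λ { {_ , z} z≡ → meets⇒inIdeal everything z
          -- Coordinate 0 is the degree, so a term of positive degree meets the full set.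
          (zero , tt , ≡.subst (0 ℕ.<_) (≡.sym (≡.trans (coord-degree z) z≡)) (ℕ.s≤s ℕ.z≤n)) }) ps))
      positive null                = combination-0 regular tt _
      positive (plus p q)          = span-+ regular (positive p) (positive q)
      positive (resp xs≈ys p)      = resp-≈ᴹ regular xs≈ys (positive p)

-- The lecture hall monoid

private
  -- The order on unnormalised fractions is cross-multiplication by definition, so the product is
  -- identified with a fraction there. The denominator of `mkℚᵘ p c` is `suc c`.
  toℚᵘ-1/c*p : ∀ c p → ℚ.toℚᵘ ((+ 1 ℚ./ suc c) ℚ.* fromℤ p) ℚᵘ.≃ ℚᵘ.mkℚᵘ p c
  toℚᵘ-1/c*p c p = ℚᵘₚ.≃-trans (ℚₚ.toℚᵘ-homo-* (+ 1 ℚ./ suc c) (fromℤ p))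
    (ℚᵘₚ.≃-trans (ℚᵘₚ.*-congʳ {ℚ.toℚᵘ (fromℤ p)} (ℚₚ.toℚᵘ-fromℚᵘ (ℚᵘ.mkℚᵘ (+ 1) c)))
      (ℚᵘ.*≡* (≡.cong₂ ℤ._*_ (ℤₚ.*-identityˡ p) (≡.sym (ℤₚ.*-identityʳ (+ suc c))))))

1/c*p≤1/d*q⇒p*d≤q*c : ∀ c d .{{_ : NonZero c}} .{{_ : NonZero d}} p q →
  (+ 1 ℚ./ c) ℚ.* fromℤ p ℚ.≤ (+ 1 ℚ./ d) ℚ.* fromℤ q → p ℤ.* + d ℤ.≤ q ℤ.* + c
1/c*p≤1/d*q⇒p*d≤q*c (suc c) (suc d) p q ≤ = ℚᵘₚ.drop-*≤*
  (ℚᵘₚ.≤-respʳ-≃ (toℚᵘ-1/c*p d q) (ℚᵘₚ.≤-respˡ-≃ (toℚᵘ-1/c*p c p) (ℚₚ.toℚᵘ-mono-≤ ≤)))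

p*d≤q*c⇒1/c*p≤1/d*q : ∀ c d .{{_ : NonZero c}} .{{_ : NonZero d}} p q →
  p ℤ.* + d ℤ.≤ q ℤ.* + c → (+ 1 ℚ./ c) ℚ.* fromℤ p ℚ.≤ (+ 1 ℚ./ d) ℚ.* fromℤ q
p*d≤q*c⇒1/c*p≤1/d*q (suc c) (suc d) p q ≤ = ℚₚ.toℚᵘ-cancel-≤
  (ℚᵘₚ.≤-respʳ-≃ (ℚᵘₚ.≃-sym (toℚᵘ-1/c*p d q))
    (ℚᵘₚ.≤-respˡ-≃ (ℚᵘₚ.≃-sym (toℚᵘ-1/c*p c p)) (ℚᵘ.*≤* ≤)))

-- Integer vectors below a bound, in lexicographic order

vectors : ∀ {m} → Vector ℕ m → List (Vector ℕ m)
vectors {zero}  b = V.[] ∷ []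
vectors {suc m} b = concat (map (λ a → map (a V.∷_) (vectors (b ∘ suc))) (upTo (suc (b zero))))

vectors-complete : ∀ {m} (b u : Vector ℕ m) → (∀ i → u i ℕ.≤ b i) → Any (u ≗_) (vectors b)
vectors-complete {zero}  b u u≤b = here λ ()
vectors-complete {suc m} b u u≤b = Anyₚ.concat⁺ (Anyₚ.map⁺ (Any.map
  (λ { ≡.refl → Anyₚ.map⁺ (Any.map (λ { u≗v zero → ≡.refl ; u≗v (suc i) → u≗v i })
    (vectors-complete (b ∘ suc) (u ∘ suc) (u≤b ∘ suc))) })
  (∈-upTo⁺ (ℕ.s≤s (u≤b zero)))))

-- Lexicographically, a later vector has a larger head, or the same head and a later tail; in
-- neither case is it below an earlier one.
vectors-increasing : ∀ {m} (b : Vector ℕ m) → AllPairs (λ u v → ¬ (∀ i → v i ℕ.≤ u i)) (vectors b)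
vectors-increasing {zero}  b = [] ∷ []
vectors-increasing {suc m} b = AllPairsₚ.concat⁺
  (Allₚ.map⁺ (All.universal (λ a → AllPairsₚ.map⁺ {f = a V.∷_} (AllPairs.map (λ u≱v v≤u → u≱v (v≤u ∘ suc))
    (vectors-increasing (b ∘ suc)))) (upTo (suc (b zero)))))
  (AllPairsₚ.map⁺ {f = λ a → map (a V.∷_) (vectors (b ∘ suc))} (AllPairsₚ.applyUpTo⁺₁ id (suc (b zero)) λ a<a′ _ →
    Allₚ.map⁺ (All.universal (λ u → Allₚ.map⁺ (All.universal
      (λ v v≤u → ℕₚ.<⇒≱ a<a′ (v≤u zero)) (vectors (b ∘ suc)))) (vectors (b ∘ suc)))))

-- Truncation of lecture hall points

module LectureHallTruncations {n : ℕ} (b : Vector ℕ (suc n)) (b>0 : ∀ i → NonZero (b i)) where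

  open LectureHall b b>0
  open ≡ using (refl)
  private module M = CommutativeMonoid exponents
  open MonomialIdeals Complex.commutativeRing exponents _≟_ height height-isMonoidHomomorphism

  -- The inequalities 0 ≤ u₁/b₁ ≤ ⋯ ≤ uₙ/bₙ ≤ k with denominators cleared.
  IntegerChain : ℕ → Vector ℕ (suc n) → Set
  IntegerChain k u =
    (∀ i → u (Fin.inject₁ i) ℕ.* b (suc i) ℕ.≤ u (suc i) ℕ.* b (Fin.inject₁ i)) ×
    u (Fin.fromℕ n) ℕ.≤ k ℕ.* b (Fin.fromℕ n)

  integerChain? : ∀ k u → Dec (IntegerChain k u)
  integerChain? k u = Finₚ.all? (λ i → _ ℕₚ.≤? _) ×-dec (_ ℕₚ.≤? _)

  integerChain-resp : ∀ {k u v} → u ≗ v → IntegerChain k u → IntegerChain k v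
  integerChain-resp {k} u≗v (steps , upper) =
    (λ i → ≡.subst₂ (λ p q → p ℕ.* b (suc i) ℕ.≤ q ℕ.* b (Fin.inject₁ i))
      (u≗v (Fin.inject₁ i)) (u≗v (suc i)) (steps i)) ,
    ≡.subst (ℕ._≤ k ℕ.* b (Fin.fromℕ n)) (u≗v (Fin.fromℕ n)) upper

  private
    fromℤ≡ : ∀ p → fromℤ p ≡ (+ 1 ℚ./ 1) ℚ.* fromℤ p
    fromℤ≡ p = ≡.sym (ℚₚ.*-identityˡ (fromℤ p))

    +-cancel-≤ : ∀ u c v d → + u ℤ.* + d ℤ.≤ + v ℤ.* + c → u ℕ.* d ℕ.≤ v ℕ.* c
    +-cancel-≤ u c v d ≤ = ℤₚ.drop‿+≤+ (≡.subst₂ ℤ._≤_ (≡.sym (ℤₚ.pos-* u d)) (≡.sym (ℤₚ.pos-* v c)) ≤)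

    +-mono-≤ : ∀ u c v d → u ℕ.* d ℕ.≤ v ℕ.* c → + u ℤ.* + d ℤ.≤ + v ℤ.* + c
    +-mono-≤ u c v d ≤ = ≡.subst₂ ℤ._≤_ (ℤₚ.pos-* u d) (ℤₚ.pos-* v c) (ℤ.+≤+ ≤)

  entry : Vec.Vec ℤ (suc n) → Vector ℕ (suc n)
  entry p i = ∣ Vec.lookup p i ∣

  entry-nonNegative : ∀ {k p} → LatticePoint k p → ∀ i → + entry p i ≡ Vec.lookup p i
  entry-nonNegative {k} {p} P i = ℤₚ.0≤i⇒+∣i∣≡i (≡.subst₂ ℤ._≤_ refl (ℤₚ.*-identityʳ (Vec.lookup p i))
    -- The bound `0ℚ` is read as 1/1 times 0, a chain term with denominator 1.
    (1/c*p≤1/d*q⇒p*d≤q*c 1 (b i) {{_}} {{b>0 i}} (+ 0) (Vec.lookup p i)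
      (chain-lower _ (LatticePoint⇒RationalChain {k} {p} P) i)))

  entry-≤ : ∀ {k p} → LatticePoint k p → ∀ i → entry p i ℕ.≤ k ℕ.* b i
  entry-≤ {k} {p} P i = ≡.subst (ℕ._≤ k ℕ.* b i) (ℕₚ.*-identityʳ (entry p i))
    (+-cancel-≤ (entry p i) (b i) k 1 (≡.subst (λ z → z ℤ.* + 1 ℤ.≤ + k ℤ.* + b i)
      (≡.sym (entry-nonNegative {k} {p} P i))
      (1/c*p≤1/d*q⇒p*d≤q*c (b i) 1 {{b>0 i}} (Vec.lookup p i) (+ k)
        (≡.subst (1/b i ℚ.* fromℤ (Vec.lookup p i) ℚ.≤_) (fromℤ≡ (+ k))
          (chain-upper _ (LatticePoint⇒RationalChain {k} {p} P) i)))))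

  integerChain : ∀ {k p} → LatticePoint k p → IntegerChain k (entry p)
  integerChain {k} {p} P = steps , entry-≤ {k} {p} P (Fin.fromℕ n)
    where
    steps : ∀ i → entry p (Fin.inject₁ i) ℕ.* b (suc i) ℕ.≤ entry p (suc i) ℕ.* b (Fin.inject₁ i)
    steps i = +-cancel-≤ (entry p (Fin.inject₁ i)) (b (Fin.inject₁ i)) (entry p (suc i)) (b (suc i))
      (≡.subst₂ (λ y z → y ℤ.* + b (suc i) ℤ.≤ z ℤ.* + b (Fin.inject₁ i))
        (≡.sym (entry-nonNegative {k} {p} P (Fin.inject₁ i))) (≡.sym (entry-nonNegative {k} {p} P (suc i)))
        (1/c*p≤1/d*q⇒p*d≤q*c (b (Fin.inject₁ i)) (b (suc i)) {{b>0 (Fin.inject₁ i)}} {{b>0 (suc i)}} _ _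
          (proj₁ (proj₂ (LatticePoint⇒RationalChain {k} {p} P)) i)))

  point : Vector ℕ (suc n) → Vec.Vec ℤ (suc n)
  point u = Vec.tabulate (+_ ∘ u)

  lookup-point : ∀ u i → Vec.lookup (point u) i ≡ + u i
  lookup-point u = Vecₚ.lookup∘tabulate (+_ ∘ u)

  entry-point : ∀ u i → entry (point u) i ≡ u i
  entry-point u i = ≡.cong ∣_∣ (lookup-point u i)

  latticePoint : ∀ k u → IntegerChain k u → LatticePoint k (point u)
  latticePoint k u (steps , upper) = RationalChain⇒LatticePoint {k} {point u}
    (first , (λ i → term (Fin.inject₁ i) (suc i) (steps i)) , last)
    where
    first : 0ℚ ℚ.≤ 1/b zero ℚ.* fromℤ (Vec.lookup (point u) zero)
    first rewrite lookup-point u zero =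
      p*d≤q*c⇒1/c*p≤1/d*q 1 (b zero) {{_}} {{b>0 zero}} (+ 0) (+ u zero)
        (+-mono-≤ 0 1 (u zero) (b zero) ℕ.z≤n)
    term : ∀ i j → u i ℕ.* b j ℕ.≤ u j ℕ.* b i →
           1/b i ℚ.* fromℤ (Vec.lookup (point u) i) ℚ.≤ 1/b j ℚ.* fromℤ (Vec.lookup (point u) j)
    term i j ≤ rewrite lookup-point u i | lookup-point u j =
      p*d≤q*c⇒1/c*p≤1/d*q (b i) (b j) {{b>0 i}} {{b>0 j}} (+ u i) (+ u j) (+-mono-≤ (u i) (b i) (u j) (b j) ≤)
    last : 1/b (Fin.fromℕ n) ℚ.* fromℤ (Vec.lookup (point u) (Fin.fromℕ n)) ℚ.≤ fromℤ (+ k)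
    last rewrite lookup-point u (Fin.fromℕ n) | fromℤ≡ (+ k) =
      p*d≤q*c⇒1/c*p≤1/d*q (b (Fin.fromℕ n)) 1 {{b>0 (Fin.fromℕ n)}} (+ u (Fin.fromℕ n)) (+ k)
        (+-mono-≤ (u (Fin.fromℕ n)) (b (Fin.fromℕ n)) k 1
          (≡.subst (ℕ._≤ k ℕ.* b (Fin.fromℕ n)) (≡.sym (ℕₚ.*-identityʳ _)) upper))

  exponent : ∀ k u → IntegerChain k u → M.Carrier
  exponent k u chain = (point u , k) , latticePoint k u chain

  coord : M.Carrier → Vector ℕ (suc (suc n))
  coord ((p , k) , _) = k V.∷ entry p

  -- After cross-multiplication both sides are minima of the common product b_i b_{i+1} with the two
  -- sides of the old inequality. The upper bound is the same inequality for the degree coordinate,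
  -- where `b` is 1.
  integerChain-⊓ : ∀ k u → IntegerChain k u → IntegerChain (1 ⊓ k) (λ i → b i ⊓ u i)
  integerChain-⊓ k u (steps , upper) =
    (λ i → ≡.subst₂ ℕ._≤_ (≡.sym (ℕₚ.*-distribʳ-⊓ (b (suc i)) (b (Fin.inject₁ i)) (u (Fin.inject₁ i))))
      (≡.sym (ℕₚ.*-distribʳ-⊓ (b (Fin.inject₁ i)) (b (suc i)) (u (suc i))))
      (ℕₚ.⊓-mono-≤ (ℕₚ.≤-reflexive (ℕₚ.*-comm (b (Fin.inject₁ i)) (b (suc i)))) (steps i))) ,
    ≡.subst (b (Fin.fromℕ n) ⊓ u (Fin.fromℕ n) ℕ.≤_) (≡.sym (ℕₚ.*-distribʳ-⊓ (b (Fin.fromℕ n)) 1 k))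
      (ℕₚ.⊓-mono-≤ (ℕₚ.≤-reflexive (≡.sym (ℕₚ.*-identityˡ (b (Fin.fromℕ n))))) upper)

  -- After cross-multiplication both sides lose the same product b_i b_{i+1}, and truncated
  -- subtraction is monotone.
  integerChain-∸ : ∀ k u → IntegerChain k u → IntegerChain (k ∸ 1) (λ i → u i ∸ b i)
  integerChain-∸ k u (steps , upper) =
    (λ i → ≡.subst₂ ℕ._≤_ (≡.sym (ℕₚ.*-distribʳ-∸ (b (suc i)) (u (Fin.inject₁ i)) (b (Fin.inject₁ i))))
      (≡.sym (ℕₚ.*-distribʳ-∸ (b (Fin.inject₁ i)) (u (suc i)) (b (suc i))))
      (ℕₚ.∸-mono (steps i) (ℕₚ.≤-reflexive (ℕₚ.*-comm (b (suc i)) (b (Fin.inject₁ i)))))) ,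
    ≡.subst (u (Fin.fromℕ n) ∸ b (Fin.fromℕ n) ℕ.≤_) (≡.sym (ℕₚ.*-distribʳ-∸ (b (Fin.fromℕ n)) k 1))
      (ℕₚ.∸-mono upper (ℕₚ.≤-reflexive (ℕₚ.*-identityˡ (b (Fin.fromℕ n)))))

  -- A recursion rather than a `filter`, because each exponent is built from the proof that its
  -- vector is a chain.
  exponents₁ : List (Vector ℕ (suc n)) → List M.Carrier
  exponents₁ []       = []
  exponents₁ (u ∷ us) with integerChain? 1 u
  ... | yes chain = exponent 1 u chain ∷ exponents₁ us
  ... | no  _     = exponents₁ us

  exponents₁-height : ∀ us → All (λ x → height x ≡ 1) (exponents₁ us)
  exponents₁-height []       = []
  exponents₁-height (u ∷ us) with integerChain? 1 u
  ... | yes chain = refl ∷ exponents₁-height us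
  ... | no  _     = exponents₁-height us

  -- Coordinates are absolute values, which lose nothing since the entries of lattice points are
  -- nonnegative.
  coord-injective : ∀ {x y} → (∀ j → coord x j ≡ coord y j) → x M.≈ y
  coord-injective {(p , j) , P} {(q , k) , Q} x≡y = ≡.cong₂ _,_
    (≡.trans (≡.sym (Vecₚ.tabulate∘lookup p)) (≡.trans (Vecₚ.tabulate-cong λ i →
      ≡.trans (≡.sym (entry-nonNegative {j} {p} P i)) (≡.trans (≡.cong +_ (x≡y (suc i))) (entry-nonNegative {k} {q} Q i)))
      (Vecₚ.tabulate∘lookup q)))
    (x≡y zero)

  exponents₁-complete : ∀ us x → height x ≡ 1 → Any (coord x ∘ suc ≗_) us → Any (x M.≈_) (exponents₁ us)
  exponents₁-complete (u ∷ us) x@((p , k) , P) refl i with integerChain? 1 u | i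
  ... | yes chain | here x≗u = here (coord-injective {x} {exponent 1 u chain} λ
    { zero → refl ; (suc j) → ≡.trans (x≗u j) (≡.sym (entry-point u j)) })
  ... | yes chain | there i′ = there (exponents₁-complete us x refl i′)
  ... | no ¬chain | here x≗u = contradiction (integerChain-resp {1} x≗u (integerChain {1} {p} P)) ¬chain
  ... | no ¬chain | there i′ = exponents₁-complete us x refl i′

  exponents₁-increasing : ∀ us → AllPairs (λ u v → ¬ (∀ i → v i ℕ.≤ u i)) us →
                          AllPairs (λ x y → ¬ (∀ j → coord y j ℕ.≤ coord x j)) (exponents₁ us)
  exponents₁-increasing []       []             = []
  exponents₁-increasing (u ∷ us) (u≱us ∷ us-inc) with integerChain? 1 u
  ... | yes chain = go us u≱us ∷ exponents₁-increasing us us-inc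
    where
    go : ∀ vs → All (λ v → ¬ (∀ i → v i ℕ.≤ u i)) vs →
         All (λ y → ¬ (∀ j → coord y j ℕ.≤ coord (exponent 1 u chain) j)) (exponents₁ vs)
    go []       []           = []
    go (v ∷ vs) (u≱v ∷ u≱vs) with integerChain? 1 v
    ... | yes _ = (λ v≤u → u≱v λ i → ≡.subst₂ ℕ._≤_ (entry-point v i) (entry-point u i) (v≤u (suc i))) ∷ go vs u≱vs
    ... | no  _ = go vs u≱vs
  ... | no  _     = exponents₁-increasing us us-inc

  truncations : Truncations (suc n)
  truncations = record
    { coord           = coord
    ; coord-cong      = λ { refl j → refl }
    ; coord-injective = λ {x} {y} → coord-injective {x} {y}
    ; coord-∙         = coord-∙
    ; coord-degree    = λ x → refl
    -- At height 0 the bound k b_i on the entries is 0.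
    ; degree-0        = λ { ((p , k) , P) refl zero → refl
                          ; ((p , k) , P) refl (suc i) → ℕₚ.n≤0⇒n≡0 (entry-≤ {k} {p} P i) }
    ; b               = 1 V.∷ b
    ; b-degree        = refl
    ; b>0             = λ { zero → ℕ.s≤s ℕ.z≤n ; (suc i) → ℕ.>-nonZero⁻¹ (b i) {{b>0 i}} }
    ; truncate        = λ { ((p , k) , P) →
        exponent (1 ⊓ k) (λ i → b i ⊓ entry p i) (integerChain-⊓ k (entry p) (integerChain {k} {p} P)) }
    ; remainder       = λ { ((p , k) , P) →
        exponent (k ∸ 1) (λ i → entry p i ∸ b i) (integerChain-∸ k (entry p) (integerChain {k} {p} P)) }
    ; coord-truncate  = λ { _ zero → refl ; ((p , k) , P) (suc i) → entry-point (λ i → b i ⊓ entry p i) i }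
    ; coord-remainder = λ { _ zero → refl ; ((p , k) , P) (suc i) → entry-point (λ i → entry p i ∸ b i) i }
    ; box             = exponents₁ (vectors b)
    ; box-degree      = exponents₁-height (vectors b)
    ; box-complete    = λ { x@((p , k) , P) refl → exponents₁-complete (vectors b) x refl
        (vectors-complete b (entry p) (λ i → ≡.subst (entry p i ℕ.≤_) (ℕₚ.*-identityˡ (b i)) (entry-≤ {k} {p} P i))) }
    ; box-increasing  = exponents₁-increasing (vectors b) (vectors-increasing b)
    }
    where
    coord-∙ : ∀ x y j → coord (x M.∙ y) j ≡ coord x j ℕ.+ coord y j
    coord-∙ x y zero = refl
    coord-∙ ((p , j) , P) ((q , k) , Q) (suc i) = ≡.cong ∣_∣ (≡.trans (Vecₚ.lookup-zipWith ℤ._+_ i p q)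
      (≡.cong₂ ℤ._+_ (≡.sym (entry-nonNegative {j} {p} P i)) (≡.sym (entry-nonNegative {k} {q} Q i))))

-- With A first, unification finds the level arguments of gradedAlgebra in the form in which they
-- occur in A. If they differ syntactically, checking that refl proves the equation takes very long.
koszul-monoidAlgebra :
  ∀ {c ℓ m ℓm} {K : CommutativeRing c ℓ} (A : GradedAlgebra K (c ⊔ m) (ℓ ⊔ m) (c ⊔ ℓ ⊔ m))
  (M : CommutativeMonoid m ℓm) (_≟_ : Decidable (CommutativeMonoid._≈_ M))
  (degree : CommutativeMonoid.Carrier M → ℕ)
  (hom : IsMonoidHomomorphism (CommutativeMonoid.rawMonoid M) ℕ.+-0-rawMonoid degree) →
  A ≡ MonoidAlgebra.gradedAlgebra K M _≟_ degree hom →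
  ∀ {n} → MonomialIdeals.Truncations K M _≟_ degree hom n → Koszul A
koszul-monoidAlgebra {K = K} _ M _≟_ degree hom ≡.refl = MonomialIdeals.koszul K M _≟_ degree hom

theorem6p7 : (n : ℕ) (b : Vector ℕ (suc n)) (b>0 : (i : Fin (suc n)) → NonZero (b i)) → Koszul (ehrhartRing b b>0)
theorem6p7 n b b>0 = koszul-monoidAlgebra {0ℓ} {0ℓ} {_} {0ℓ} (ehrhartRing b b>0)
  (LectureHall.exponents b b>0) (LectureHall._≟_ b b>0)
  (LectureHall.height b b>0) (LectureHall.height-isMonoidHomomorphism b b>0)
  ≡.refl (LectureHallTruncations.truncations b b>0)
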